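{- Let $n\ge 1$ and let $G$ be a bipartite graph with $\binom{n+1}{2}$ edges. Let $d_1\le d_2\le\cdots\le d_k$ be the degree sequence of the vertices of one of the stable sets (colour classes) of $G$. If $$d_{k-i}\ge n-i\quad\text{for each } 0\le i\le k-1,$$ then $G$ admits a star-forest ascending subgraph decomposition.
   Context: All graphs are finite and simple. A star forest is a forest each of whose connected components is a star. A graph $G$ with $\binom{n+1}{2}$ edges has an ascending subgraph decomposition (ASD) if its edge set can be partitioned as $G=G_1\oplus\cdots\oplus G_n$ (edge-disjoint union) where $G_i$ has exactly $i$ edges and $G_i$ is isomorphic to a subgraph of $G_{i+1}$ for $1\le i<n$. A star-forest ASD is an ASD in which every $G_i$ is a star forest. -}

module Defs where

open import Data.Bool using (Bool; true; false; _∧_; T)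
open import Data.Nat using (ℕ; zero; suc; _∸_; _≤_; _<_)
open import Data.Nat.Properties using (≤-decTotalOrder)
open import Data.Nat.Combinatorics using (_C_)
open import Data.Fin using (Fin; toℕ)
open import Data.Fin.Properties using () renaming (_≟_ to _≟ᶠ_)
open import Data.List using (List; length; filterᵇ; map; allFin; concatMap; lookup; _∷_; [])
open import Data.List.Sort ≤-decTotalOrder using (sort)
open import Data.Product using (Σ; ∃; _×_; _,_; proj₁; proj₂)
open import Data.Sum using (_⊎_)
open import Relation.Nullary using (¬_)
open import Relation.Nullary.Decidable using (⌊_⌋)
open import Relation.Binary.PropositionalEquality using (_≡_; _≢_)
open import Function.Definitions using (Injective)

record Graph (v : ℕ) : Set where
  field
    adj   : Fin v → Fin v → Bool
    sym   : ∀ x y → adj x y ≡ adj y x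
    irrefl : ∀ x → adj x x ≡ false
open Graph public

pairs : (v : ℕ) → List (Fin v × Fin v)
pairs v = concatMap (λ x → map (λ y → (x , y)) (allFin v)) (allFin v)

_<ᵇᶠ_ : ∀ {v} → Fin v → Fin v → Bool
x <ᵇᶠ y = ⌊ Data.Nat._<?_ (toℕ x) (toℕ y) ⌋

numEdgesRel : ∀ {v} → (Fin v → Fin v → Bool) → ℕ
numEdgesRel {v} r = length (filterᵇ (λ p → (proj₁ p <ᵇᶠ proj₂ p) ∧ r (proj₁ p) (proj₂ p)) (pairs v))

numEdges : ∀ {v} → Graph v → ℕ
numEdges G = numEdgesRel (adj G)

degree : ∀ {v} → Graph v → Fin v → ℕ
degree {v} G x = length (filterᵇ (adj G x) (allFin v))

Proper2Colouring : ∀ {v} → Graph v → (Fin v → Bool) → Set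
Proper2Colouring G c = ∀ x y → adj G x y ≡ true → c x ≢ c y

Bipartite : ∀ {v} → Graph v → Set
Bipartite G = ∃ λ c → Proper2Colouring G c

degSeq : ∀ {v} → Graph v → (Fin v → Bool) → List ℕ
degSeq {v} G c = sort (map (degree G) (filterᵇ c (allFin v)))

-- The hypothesis: with d_1 ≤ … ≤ d_k the degree sequence (so d_{j+1} is
-- entry j, 0-based), d_{k-i} ≥ n - i for all 0 ≤ i ≤ k-1.  Writing the
-- 0-based index j = k-1-i, i.e. i = k - (j+1), this reads:
DegreeCondition : ℕ → List ℕ → Set
DegreeCondition n ds = ∀ (j : Fin (length ds)) → n ∸ (length ds ∸ suc (toℕ j)) ≤ lookup ds j

data Reach {v : ℕ} (r : Fin v → Fin v → Bool) : Fin v → Fin v → Set where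
  here : ∀ {x} → Reach r x x
  step : ∀ {x y z} → r x y ≡ true → Reach r y z → Reach r x z

-- A (symmetric, irreflexive) relation is a star forest: every connected
-- component is a star, i.e. each component has a centre c such that every
-- edge inside the component contains c.  (Stars are trees, so this is a
-- forest all of whose components are stars.)
StarForest : ∀ {v} → (Fin v → Fin v → Bool) → Set
StarForest {v} r = ∀ (x : Fin v) → ∃ λ (c : Fin v) → Reach r x c ×
  (∀ y z → Reach r x y → r y z ≡ true → (y ≡ c ⊎ z ≡ c))

-- An edge decomposition of G into n edge-disjoint parts G_0,…,G_{n-1}
-- (the paper's G_1,…,G_n) given by a symmetric labelling of the edges;
-- part i consists of the edges with label i.
part : ∀ {v n} → Graph v → (Fin v → Fin v → Fin n) → Fin n → Fin v → Fin v → Bool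
part G lab i x y = adj G x y ∧ ⌊ lab x y ≟ᶠ i ⌋

IsoToSubgraph : ∀ {v} → (Fin v → Fin v → Bool) → (Fin v → Fin v → Bool) → Set
IsoToSubgraph {v} H K = ∃ λ (φ : Fin v → Fin v) → Injective _≡_ _≡_ φ ×
  (∀ x y → H x y ≡ true → K (φ x) (φ y) ≡ true)

record StarForestASD {v : ℕ} (G : Graph v) (n : ℕ) : Set where
  field
    label     : Fin v → Fin v → Fin n
    label-sym : ∀ x y → label x y ≡ label y x
    size      : ∀ i → numEdgesRel (part G label i) ≡ suc (toℕ i)
    starF     : ∀ i → StarForest (part G label i)
    ascending : ∀ i j → toℕ j ≡ suc (toℕ i) →
                IsoToSubgraph (part G label i) (part G label j)

{-# OPTIONS --safe #-}
module Submission where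

-- Let L be the chosen colour class, ordered by descending degree, k = |L|.  The parts are split
-- off from G_n down to G_1.  In G_j the first min(j,k) vertices of L receive one edge each, and the
-- remaining j ∸ k edges form a "hook": x edges at one vertex r and one edge at each of h − 1
-- others, where x + h − 1 = j ∸ k.  As long as the i-th vertex still has degree ≥ j ∸ i (i ≥ 0), the
-- right ends of all these edges can be chosen distinct greedily, so G_j is a star forest.
--
-- The hooks eat up the surplus s of the degrees over the staircase n, n − 1, …; its total is the
-- triangular number of m = n ∸ k.  At each stage h is the largest number such that
-- Σ_x min(s(x), c) ≥ Σ_{i ≤ h} min(i, c) for all c; r has the largest surplus and the h − 1 others
-- have the next largest ones.  After the removal the largest such number is h or h − 1, so the hooks,
-- and with them the parts, are ascending up to a permutation of L.

open import Defs renaming (sym to adj-sym; here to stay; step to move)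
import Data.Bool as Bool
open import Data.Bool using (Bool; true; false; _∧_; if_then_else_)
open import Data.Bool.Properties using (T-≡)
open import Data.Empty using (⊥)
open import Data.Fin using (Fin; toℕ; fromℕ<) renaming (zero to fzero; suc to fsuc)
open import Data.Fin.Properties using (any?; toℕ<n; toℕ-fromℕ<; toℕ-injective) renaming (_≟_ to _≟ᶠ_)
open import Data.List using (List; []; _∷_; _++_; map; length; take; replicate; reverse; filterᵇ; allFin; concatMap; cartesianProduct)
open import Data.List.Properties using (map-++; map-∘; map-id; map-cong-local; map-replicate; length-map; length-++; length-replicate; length-take; take-map; take-all; unfold-reverse; ∷-injective; ++-identityʳ; ++-assoc)
open import Data.List.Membership.Propositional using (_∈_; _∉_; find)
import Data.List.Membership.DecPropositional as DecMembership
open import Data.List.Membership.Propositional.Properties using (∈-++⁺ˡ; ∈-++⁺ʳ; ∈-++⁻; ∈-map⁺; ∈-map⁻; ∈-∃++; ∈-allFin; ∈-filter⁺; ∈-filter⁻; ∈-cartesianProduct⁺)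
open import Data.List.Membership.Propositional.Properties.WithK using (unique∧set⇒bag)
open import Data.List.Relation.Binary.BagAndSetEquality using (∼bag⇒↭)
open import Data.List.Relation.Binary.Permutation.Propositional using (_↭_; ↭-sym; ↭-trans; ↭-refl; ↭-reflexive; prep; swap; ↭⇒↭ₛ)
open import Data.List.Relation.Binary.Permutation.Propositional.Properties using (∈-resp-↭; All-resp-↭; shift; ↭-length; ↭-reverse; ↭-map-inv; ++⁺; ++⁺ˡ; ++-comm) renaming (map⁺ to ↭-map⁺)
import Data.List.Relation.Binary.Permutation.Setoid.Properties as ↭ₛ
open import Data.List.Relation.Unary.All as All using (All; []; _∷_)
open import Data.List.Relation.Unary.All.Properties using (¬All⇒Any¬) renaming (map⁺ to All-map⁺; ++⁻ˡ to All-++⁻ˡ)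
open import Data.List.Relation.Unary.AllPairs using ([]; _∷_)
open import Data.List.Relation.Unary.Any using (here; there)
open import Data.List.Relation.Unary.Unique.Propositional using (Unique)
open import Data.List.Relation.Unary.Unique.Propositional.Properties using (Unique[x∷xs]⇒x∉xs; allFin⁺; filter⁺; cartesianProduct⁺) renaming (map⁺ to Unique-map⁺; map⁻ to Unique-map⁻; ++⁺ to Unique-++⁺)
open import Data.Nat
open import Data.Nat.Properties
open import Data.Nat.Combinatorics using (_C_; nC1≡n; nCk+nC[k+1]≡[n+1]C[k+1])
open import Data.Nat.ListAction using (sum)
open import Data.Nat.ListAction.Properties using (sum-↭; sum-++)
open import Data.Nat.Tactic.RingSolver using (solve-∀)
open import Data.List.Sort ≤-decTotalOrder using (sort-↭)
open import Data.Product using (∃; ∃₂; _×_; _,_; proj₁; proj₂) renaming (swap to ×-swap)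
open import Data.Product.Properties using (≡-dec; ,-injectiveʳ)
open import Data.Sum using (_⊎_; inj₁; inj₂; [_,_]′)
open import Data.Unit using (⊤; tt)
open import Function using (_∘_; id; case_of_)
open import Function.Bundles using (Equivalence; mk⇔)
open import Function.Definitions using (Injective)
open import Relation.Binary using (DecidableEquality; tri<; tri≈; tri>)
open import Relation.Binary.PropositionalEquality
open import Relation.Nullary using (¬_; Dec; yes; no; contradiction; does)
open import Relation.Nullary.Decidable using (⌊_⌋; dec-true; dec-false)
open import Relation.Nullary.Decidable.Core using (T?)

-- Staircases and hook removal

-- A part with distinct right ends is a union of disjoint stars centred in L, hence given up to
-- isomorphism by the multiset of its left ends. So it remains to write the degrees as a sum of
-- multisets, each embedding in the next after a relabelling of L. The obstacle is that the surplus
-- may sit at a few vertices or be spread over many, and this changes as hooks are removed, so no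
-- shape of hook can be fixed in advance. Maximality of h supplies both bounds. Domination by the
-- staircase (h, ..., 1) yields h vertices with positive surplus, and lowering the h largest entries
-- by one leaves domination by (h - 1, ..., 1). Failure for h + 1 means that few entries are large;
-- as the total is triangular, the largest entry can then pay for the long star. Removal only lowers
-- surpluses, so h cannot grow. Since the hook loses one edge per stage, either its long star
-- shrinks by one edge or one of its single edges disappears.

triangle : ℕ → ℕ
triangle zero    = 0
triangle (suc n) = suc n + triangle n

triangle-+ : ∀ a b → triangle (a + b) ≡ triangle a + a * b + triangle b
triangle-+ a zero rewrite +-identityʳ a | *-zeroʳ a | +-identityʳ (triangle a) | +-identityʳ (triangle a) = refl
triangle-+ a (suc b) rewrite +-suc a b | triangle-+ a b = lemma a b (triangle a) (triangle b)
  where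
  lemma : ∀ a b s t → suc (a + b) + (s + a * b + t) ≡ s + a * suc b + (suc b + t)
  lemma = solve-∀

triangle-mono : ∀ {a b} → a ≤ b → triangle a ≤ triangle b
triangle-mono z≤n       = z≤n
triangle-mono (s≤s a≤b) = +-mono-≤ (s≤s a≤b) (triangle-mono a≤b)

triangle-cancel-≤ : ∀ {a b} → triangle a ≤ triangle b → a ≤ b
triangle-cancel-≤ {a} {b} Ta≤Tb with a ≤? b
... | yes a≤b = a≤b
... | no  a≰b = contradiction
  (≤-trans (+-monoˡ-≤ (triangle b) (s≤s z≤n)) (≤-trans (triangle-mono (≰⇒> a≰b)) Ta≤Tb)) (<-irrefl refl)

-- The sum of the c largest elements of {1,…,h}, i.e. Σ_{1≤j≤h} min(j,c).
stair : ℕ → ℕ → ℕ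
stair zero    h = 0
stair (suc c) h = h + stair c (pred h)

stair≤triangle : ∀ c h → stair c h ≤ triangle h
stair≤triangle zero    h       = z≤n
stair≤triangle (suc c) zero    = stair≤triangle c zero
stair≤triangle (suc c) (suc h) = +-monoʳ-≤ (suc h) (stair≤triangle c h)

stair-diag : ∀ h → stair h h ≡ triangle h
stair-diag zero    = refl
stair-diag (suc h) = cong (suc h +_) (stair-diag h)

stair-mono : ∀ c {h h'} → h ≤ h' → stair c h ≤ stair c h'
stair-mono zero    h≤h' = z≤n
stair-mono (suc c) h≤h' = +-mono-≤ h≤h' (stair-mono c (pred-mono-≤ h≤h'))

-- The increment counts the j ≤ h with j > c, hence is at most h.
stair-suc : ∀ c h → stair (suc c) h ≤ stair c h + h
stair-suc c h rewrite +-comm (stair c h) h = +-monoʳ-≤ h (stair-mono c pred[n]≤n)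

stair-1 : ∀ c → stair c 1 ≤ 1
stair-1 zero    = z≤n
stair-1 (suc c) = s≤s (stair≤triangle c 0)

-- Capped sums and domination of staircases

cappedSum : ℕ → List ℕ → ℕ
cappedSum c ns = sum (map (_⊓ c) ns)

-- A numeric indicator of `c < n` is summed; the value is part c + 1 of the conjugate partition.
countAbove : ℕ → List ℕ → ℕ
countAbove c ns = sum (map (λ n → 1 ⊓ (n ∸ c)) ns)

cappedSum-++ : ∀ c ms ns → cappedSum c (ms ++ ns) ≡ cappedSum c ms + cappedSum c ns
cappedSum-++ c ms ns = trans (cong sum (map-++ (_⊓ c) ms ns)) (sum-++ (map (_⊓ c) ms) _)

cappedSum-↭ : ∀ c {ms ns} → ms ↭ ns → cappedSum c ms ≡ cappedSum c ns
cappedSum-↭ c p = sum-↭ (↭-map⁺ (_⊓ c) p)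

cappedSum≤sum : ∀ c ns → cappedSum c ns ≤ sum ns
cappedSum≤sum c []       = z≤n
cappedSum≤sum c (n ∷ ns) = +-mono-≤ (m⊓n≤m n c) (cappedSum≤sum c ns)

cappedSum-mono : ∀ {c d} ns → c ≤ d → cappedSum c ns ≤ cappedSum d ns
cappedSum-mono []       c≤d = z≤n
cappedSum-mono (n ∷ ns) c≤d = +-mono-≤ (⊓-monoʳ-≤ n c≤d) (cappedSum-mono ns c≤d)

cappedSum-1≤length : ∀ ns → cappedSum 1 ns ≤ length ns
cappedSum-1≤length []       = z≤n
cappedSum-1≤length (n ∷ ns) = +-mono-≤ (m⊓n≤n n 1) (cappedSum-1≤length ns)

⊓-suc : ∀ n c → n ⊓ suc c ≡ n ⊓ c + 1 ⊓ (n ∸ c)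
⊓-suc zero    c       rewrite 0∸n≡0 c = refl
⊓-suc (suc n) zero    rewrite ⊓-zeroʳ n = refl
⊓-suc (suc n) (suc c) = cong suc (⊓-suc n c)

cappedSum-suc : ∀ c ns → cappedSum (suc c) ns ≡ cappedSum c ns + countAbove c ns
cappedSum-suc c []       = refl
cappedSum-suc c (n ∷ ns) rewrite cappedSum-suc c ns | ⊓-suc n c =
  lemma (n ⊓ c) (1 ⊓ (n ∸ c)) (cappedSum c ns) (countAbove c ns)
  where
  lemma : ∀ a b x y → a + b + (x + y) ≡ a + x + (b + y)
  lemma = solve-∀

cappedSum-all≤ : ∀ {c ns} → All (_≤ c) ns → cappedSum c ns ≡ sum ns
cappedSum-all≤ []       = refl
cappedSum-all≤ (p ∷ ps) = cong₂ _+_ (m≤n⇒m⊓n≡m p) (cappedSum-all≤ ps)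

countAbove-all : ∀ {c ns} → All (c <_) ns → countAbove c ns ≡ length ns
countAbove-all []       = refl
countAbove-all (p ∷ ps) = cong₂ _+_ (m≤n⇒m⊓n≡m (m<n⇒0<n∸m p)) (countAbove-all ps)

sum≤cappedSum+excess : ∀ c p {ns} → All (_≤ c + p) ns → sum ns ≤ cappedSum c ns + length ns * p
sum≤cappedSum+excess c p [] = z≤n
sum≤cappedSum+excess c p {n ∷ ns} (n≤ ∷ rest) = begin
  n + sum ns                                       ≤⟨ +-mono-≤ split (sum≤cappedSum+excess c p rest) ⟩
  (n ⊓ c + p) + (cappedSum c ns + length ns * p)   ≡⟨ lemma (n ⊓ c) p (cappedSum c ns) _ ⟩
  (n ⊓ c + cappedSum c ns) + (p + length ns * p)   ∎
  where
  open ≤-Reasoning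
  split : n ≤ n ⊓ c + p
  split = ≤-trans (⊓-glb (m≤m+n n p) n≤) (≤-reflexive (sym (+-distribʳ-⊓ p n c)))
  lemma : ∀ a p x y → (a + p) + (x + y) ≡ (a + x) + (p + y)
  lemma = solve-∀

-- Only entries above c can exceed the cap c + 1, so the excess p is charged `countAbove c ns` times
-- instead of once per entry.
sum≤cappedSum+countAbove : ∀ c p {ns} → All (_≤ suc c + p) ns →
                           sum ns ≤ cappedSum (suc c) ns + countAbove c ns * p
sum≤cappedSum+countAbove c p [] = z≤n
sum≤cappedSum+countAbove c p {n ∷ ns} (n≤ ∷ rest) = begin
  n + sum ns
    ≤⟨ +-mono-≤ split (sum≤cappedSum+countAbove c p rest) ⟩
  (n ⊓ suc c + (1 ⊓ (n ∸ c)) * p) + (cappedSum (suc c) ns + countAbove c ns * p)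
    ≡⟨ lemma (n ⊓ suc c) (1 ⊓ (n ∸ c)) p (cappedSum (suc c) ns) (countAbove c ns) ⟩
  (n ⊓ suc c + cappedSum (suc c) ns) + (1 ⊓ (n ∸ c) + countAbove c ns) * p ∎
  where
  open ≤-Reasoning
  lemma : ∀ a b p x y → (a + b * p) + (x + y * p) ≡ (a + x) + (b + y) * p
  lemma = solve-∀
  split : n ≤ n ⊓ suc c + (1 ⊓ (n ∸ c)) * p
  split with n ≤? c
  ... | yes n≤c = ≤-trans (≤-reflexive (sym (m≤n⇒m⊓n≡m (m≤n⇒m≤1+n n≤c)))) (m≤m+n _ _)
  ... | no  n≰c rewrite m≤n⇒m⊓n≡m (m<n⇒0<n∸m (≰⇒> n≰c)) | +-identityʳ p =
    ≤-trans (⊓-glb (m≤m+n n p) n≤) (≤-reflexive (sym (+-distribʳ-⊓ p n (suc c))))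

-- Weak supermajorisation by the staircase (h,…,2,1), read off the conjugate partitions.
Dominates : ℕ → List ℕ → Set
Dominates h ns = ∀ c → stair c h ≤ cappedSum c ns

-- A constructive negation of `Dominates h`. The witness is a crossing and not just a violation: the
-- two inequalities together bound `countAbove c ns`.
Fails : ℕ → List ℕ → Set
Fails h ns = ∃ λ c → stair c h ≤ cappedSum c ns × cappedSum (suc c) ns < stair (suc c) h

Dominates-↭ : ∀ {h ms ns} → ms ↭ ns → Dominates h ms → Dominates h ns
Dominates-↭ p dom c = ≤-trans (dom c) (≤-reflexive (cappedSum-↭ c p))

Fails-↭ : ∀ {h ms ns} → ms ↭ ns → Fails h ms → Fails h ns
Fails-↭ p (c , le , lt) =
  c , ≤-trans le (≤-reflexive (cappedSum-↭ c p)) , ≤-<-trans (≤-reflexive (sym (cappedSum-↭ (suc c) p))) lt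

Dominates-antitone : ∀ {h h'} ns → h ≤ h' → Dominates h' ns → Dominates h ns
Dominates-antitone ns h≤h' dom c = ≤-trans (stair-mono c h≤h') (dom c)

Fails⇒¬Dominates : ∀ {h} ns → Fails h ns → ¬ Dominates h ns
Fails⇒¬Dominates ns (c , _ , lt) dom = <⇒≱ lt (dom (suc c))

-- Only caps up to h need testing: beyond h the staircase sum stays at most `triangle h`, while the
-- capped sum does not decrease. Cap 0 always holds, so the first violation is at a successor, as
-- `Fails` requires.
dominates⊎fails : ∀ h ns → Dominates h ns ⊎ Fails h ns
dominates⊎fails h ns with upTo h
  where
  upTo : ∀ b → (∀ {c} → c ≤ b → stair c h ≤ cappedSum c ns) ⊎ Fails h ns
  upTo zero = inj₁ λ { z≤n → z≤n }
  upTo (suc b) with upTo b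
  ... | inj₂ fails = inj₂ fails
  ... | inj₁ below with stair (suc b) h ≤? cappedSum (suc b) ns
  ...   | no ≰  = inj₂ (b , below ≤-refl , ≰⇒> ≰)
  ...   | yes ≤ = inj₁ λ {c} c≤ → case m≤n⇒m<n∨m≡n c≤ of λ
            { (inj₁ (s≤s c≤b)) → below c≤b ; (inj₂ refl) → ≤ }
... | inj₂ fails = inj₂ fails
... | inj₁ below = inj₁ λ c → case ≤-total c h of λ
  { (inj₁ c≤h) → below c≤h
  ; (inj₂ h≤c) → ≤-trans (stair≤triangle c h)
      (≤-trans (≤-reflexive (sym (stair-diag h))) (≤-trans (below ≤-refl) (cappedSum-mono ns h≤c))) }

-- At cap h the staircase is not truncated, so its whole triangle fits under the total.
Dominates⇒≤ : ∀ {h m} ns → sum ns ≡ triangle m → Dominates h ns → h ≤ m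
Dominates⇒≤ {h} {m} ns Σns dom = triangle-cancel-≤ (begin
  triangle h       ≡⟨ sym (stair-diag h) ⟩
  stair h h        ≤⟨ dom h ⟩
  cappedSum h ns   ≤⟨ cappedSum≤sum h ns ⟩
  sum ns           ≡⟨ Σns ⟩
  triangle m       ∎)
  where open ≤-Reasoning

Dominates-length : ∀ {h} ns → Dominates h ns → h ≤ length ns
Dominates-length {h} ns dom =
  ≤-trans (≤-reflexive (sym (+-identityʳ h))) (≤-trans (dom 1) (cappedSum-1≤length ns))

maximalStaircase : ∀ {m} ns → sum ns ≡ triangle (suc m) →
                   ∃ λ h → 1 ≤ h × Dominates h ns × Fails (suc h) ns
maximalStaircase {m} ns Σns =
  -- Fuel m + 1 starts the invariant m + 1 < h + fuel; with the fuel spent h would exceed m + 1,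
  -- against `Dominates⇒≤`.
  search (suc m) 1 ≤-refl (s≤s ≤-refl) one
  where
  positive : ∀ {ns} c → 1 ≤ sum ns → 1 ≤ cappedSum (suc c) ns
  positive {zero  ∷ ns} c 1≤ = positive {ns} c 1≤
  positive {suc n ∷ ns} c 1≤ = s≤s z≤n

  one : Dominates 1 ns
  one zero    = z≤n
  one (suc c) = ≤-trans (stair-1 (suc c)) (positive {ns} c (≤-trans (s≤s z≤n) (≤-reflexive (sym Σns))))

  search : ∀ fuel h → 1 ≤ h → suc m < h + fuel → Dominates h ns →
           ∃ λ h → 1 ≤ h × Dominates h ns × Fails (suc h) ns
  search zero h 1≤h m<h dom =
    contradiction (Dominates⇒≤ {h} {suc m} ns Σns dom) (<⇒≱ (subst (suc m <_) (+-identityʳ h) m<h))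
  search (suc f) h 1≤h m<h dom with dominates⊎fails (suc h) ns
  ... | inj₁ dom'  = search f (suc h) (s≤s z≤n) (subst (suc m <_) (+-suc h f) m<h) dom'
  ... | inj₂ fails = h , 1≤h , dom , fails

DownwardClosed : List ℕ → List ℕ → Set
DownwardClosed ys zs = ∀ {y z} → y ∈ ys → z ∈ zs → z ≤ y

-- At cap 1 domination asks for `length ys` positive entries. A zero in ys would force zs to vanish,
-- so all of them would lie in ys.
Dominates⇒positive : ∀ ys {zs} → DownwardClosed ys zs → Dominates (length ys) (ys ++ zs) → All (1 ≤_) ys
Dominates⇒positive ys {zs} top dom with All.all? (1 ≤?_) ys
... | yes all≥1 = all≥1
... | no ¬all with y , y∈ , y≱1 ← find (¬All⇒Any¬ (1 ≤?_) ys ¬all) = go ys enough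
  where
  zs≤0 : All (_≤ 0) zs
  zs≤0 = All.tabulate λ z∈ → ≤-trans (top y∈ z∈) (s≤s⁻¹ (≰⇒> y≱1))

  zs-zero : ∀ {zs} → All (_≤ 0) zs → cappedSum 1 zs ≡ 0
  zs-zero []         = refl
  zs-zero (z≤n ∷ ps) = zs-zero ps

  enough : length ys ≤ cappedSum 1 ys
  enough = begin
    length ys                       ≡⟨ sym (+-identityʳ _) ⟩
    length ys + 0                   ≤⟨ dom 1 ⟩
    cappedSum 1 (ys ++ zs)          ≡⟨ cappedSum-++ 1 ys zs ⟩
    cappedSum 1 ys + cappedSum 1 zs ≡⟨ cong (cappedSum 1 ys +_) (zs-zero zs≤0) ⟩
    cappedSum 1 ys + 0              ≡⟨ +-identityʳ _ ⟩
    cappedSum 1 ys                  ∎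
    where open ≤-Reasoning

  go : ∀ ys → length ys ≤ cappedSum 1 ys → All (1 ≤_) ys
  go []           le = []
  go (zero ∷ ys)  le = contradiction (≤-trans le (cappedSum-1≤length ys)) (<-irrefl refl)
  go (suc y ∷ ys) le = s≤s z≤n ∷ go ys (s≤s⁻¹ (subst (suc (length ys) ≤_) (cong (λ t → suc t + cappedSum 1 ys) (⊓-zeroʳ y)) le))

-- Lowering each step of (h, ..., 1) by one gives (h - 1, ..., 1). If all of ys exceed c, the
-- decrement is invisible under cap c. Otherwise all of zs are at most c, and the inequality at cap
-- c + 1 is used: in passing to cap c the staircase loses exactly h, and ys lose at most h.
Dominates-pred : ∀ ys {zs} → DownwardClosed ys zs → Dominates (length ys) (ys ++ zs) →
                 Dominates (pred (length ys)) (map pred ys ++ zs)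
Dominates-pred ys {zs} top dom c with All.all? (c <?_) ys
... | yes all> = begin
  stair c (pred (length ys))                    ≤⟨ stair-mono c pred[n]≤n ⟩
  stair c (length ys)                           ≤⟨ dom c ⟩
  cappedSum c (ys ++ zs)                        ≡⟨ cappedSum-++ c ys zs ⟩
  cappedSum c ys + cappedSum c zs               ≡⟨ cong (_+ cappedSum c zs) (sym (same all>)) ⟩
  cappedSum c (map pred ys) + cappedSum c zs    ≡⟨ sym (cappedSum-++ c (map pred ys) zs) ⟩
  cappedSum c (map pred ys ++ zs)               ∎
  where
  open ≤-Reasoning
  same : ∀ {ys} → All (c <_) ys → cappedSum c (map pred ys) ≡ cappedSum c ys
  same [] = refl
  same (c<y ∷ ps) = cong₂ _+_ (trans (m≥n⇒m⊓n≡n (pred-mono-≤ c<y)) (sym (m≥n⇒m⊓n≡n (<⇒≤ c<y)))) (same ps)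
... | no ¬all with y , y∈ , c≮y ← find (¬All⇒Any¬ (c <?_) ys ¬all) =
  +-cancelˡ-≤ (length ys) _ _ (begin
    length ys + stair c (pred (length ys))                       ≤⟨ dom (suc c) ⟩
    cappedSum (suc c) (ys ++ zs)                                 ≡⟨ cappedSum-++ (suc c) ys zs ⟩
    cappedSum (suc c) ys + cappedSum (suc c) zs                  ≤⟨ +-mono-≤ (bump ys) (≤-reflexive capped) ⟩
    (length ys + cappedSum c (map pred ys)) + cappedSum c zs     ≡⟨ +-assoc (length ys) _ _ ⟩
    length ys + (cappedSum c (map pred ys) + cappedSum c zs)     ≡⟨ cong (length ys +_) (sym (cappedSum-++ c (map pred ys) zs)) ⟩
    length ys + cappedSum c (map pred ys ++ zs)                  ∎)
  where
  open ≤-Reasoning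
  zs≤c : All (_≤ c) zs
  zs≤c = All.tabulate λ z∈ → ≤-trans (top y∈ z∈) (≮⇒≥ c≮y)

  capped : cappedSum (suc c) zs ≡ cappedSum c zs
  capped = trans (cappedSum-all≤ (All.map m≤n⇒m≤1+n zs≤c)) (sym (cappedSum-all≤ zs≤c))

  bump : ∀ ys → cappedSum (suc c) ys ≤ length ys + cappedSum c (map pred ys)
  bump [] = z≤n
  bump (y ∷ ys) = begin
    y ⊓ suc c + cappedSum (suc c) ys
      ≤⟨ +-mono-≤ (bound y) (bump ys) ⟩
    suc (pred y ⊓ c) + (length ys + cappedSum c (map pred ys))
      ≡⟨ lemma (pred y ⊓ c) (length ys) _ ⟩
    suc (length ys) + (pred y ⊓ c + cappedSum c (map pred ys)) ∎
    where
    bound : ∀ y → y ⊓ suc c ≤ suc (pred y ⊓ c)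
    bound zero    = z≤n
    bound (suc y) = ≤-refl
    lemma : ∀ a l x → suc a + (l + x) ≡ suc l + (a + x)
    lemma = solve-∀

-- The hook takes p + 1 from the largest entry a and 1 from each entry of us.
module HookRemoval (a : ℕ) (us zs : List ℕ) (p : ℕ)
  (us≤a : All (_≤ a) us)
  (top  : DownwardClosed (a ∷ us) zs)
  (Σns  : sum (a ∷ us ++ zs) ≡ triangle (suc (length us) + p))
  (dom  : Dominates (suc (length us)) (a ∷ us ++ zs))
  (fail : Fails (2 + length us) (a ∷ us ++ zs)) where

  h c* : ℕ
  h  = suc (length us)
  c* = proj₁ fail

  ns : List ℕ
  ns = a ∷ us ++ zs

  ns≤a : All (_≤ a) ns
  ns≤a = ≤-refl ∷ All.tabulate λ x∈ → 
    [ All.lookup us≤a , top (here refl) ]′ (∈-++⁻ us x∈)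

  -- The crossing at `c*` makes the increment of the capped sum smaller than that of the staircase
  -- (h + 1, ..., 1), which is at most h + 1.
  few : countAbove c* ns ≤ h
  few = s≤s⁻¹ (+-cancelˡ-< (stair c* (suc h)) _ _ (begin-strict
    stair c* (suc h) + countAbove c* ns  ≤⟨ +-monoˡ-≤ (countAbove c* ns) (proj₁ (proj₂ fail)) ⟩
    cappedSum c* ns + countAbove c* ns   ≡⟨ sym (cappedSum-suc c* ns) ⟩
    cappedSum (suc c*) ns                <⟨ proj₂ (proj₂ fail) ⟩
    stair (suc c*) (suc h)               ≤⟨ stair-suc c* (suc h) ⟩
    stair c* (suc h) + suc h             ∎))
    where open ≤-Reasoning

  -- Only h entries exceed c*, so if even the largest one were below c* + p + 1 then the total
  -- would fall short of the triangular number.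
  large : ∀ {q} → p ≡ suc q → c* + suc p ≤ a
  large {q} refl with c* + suc (suc q) ≤? a
  ... | yes le = le
  ... | no ¬le = contradiction (begin-strict
    sum ns                                               ≤⟨ sum≤cappedSum+countAbove c* q (All.map (λ x≤ → ≤-trans x≤ a≤) ns≤a) ⟩
    cappedSum (suc c*) ns + countAbove c* ns * q         <⟨ +-mono-<-≤ (proj₂ (proj₂ fail)) (*-monoˡ-≤ q few) ⟩
    stair (suc c*) (suc h) + h * q                       ≤⟨ +-mono-≤ (stair≤triangle (suc c*) (suc h)) (*-monoˡ-≤ q (n≤1+n h)) ⟩
    triangle (suc h) + suc h * q                         ≤⟨ m≤m+n _ (triangle q) ⟩
    triangle (suc h) + suc h * q + triangle q            ≡⟨ sym (triangle-+ (suc h) q) ⟩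
    triangle (suc h + q)                                 ≡⟨ cong triangle (sym (+-suc h q)) ⟩
    triangle (h + suc q)                                 ≡⟨ sym Σns ⟩
    sum ns                                               ∎) (<-irrefl refl)
    where
    open ≤-Reasoning
    a≤ : a ≤ suc c* + q
    a≤ = s≤s⁻¹ (subst (a <_) (trans (+-suc c* (suc q)) (cong suc (+-suc c* q))) (≰⇒> ¬le))

  positive : All (1 ≤_) (a ∷ us)
  positive = Dominates⇒positive (a ∷ us) top dom

  star-fits : suc p ≤ a
  star-fits = go p refl
    where
    go : ∀ q → p ≡ q → suc p ≤ a
    go zero    refl = All.head positive
    go (suc q) p≡   = ≤-trans (m≤n+m (suc p) c*) (large p≡)

  ns' : List ℕ
  ns' = (a ∸ suc p) ∷ map pred us ++ zs

  sum-pred : ∀ {us} → All (1 ≤_) us → length us + sum (map pred us) ≡ sum us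
  sum-pred [] = refl
  sum-pred {suc u ∷ us} (_ ∷ ps) = cong suc (trans (lemma (length us) u _) (cong (u +_) (sum-pred ps)))
    where
    lemma : ∀ l u x → l + (u + x) ≡ u + (l + x)
    lemma = solve-∀

  sum-removed : sum ns' ≡ triangle (length us + p)
  sum-removed = +-cancelˡ-≡ (h + p) _ _ (begin
    (h + p) + (a ∸ suc p + sum (map pred us ++ zs))
      ≡⟨ cong (λ t → h + p + (a ∸ suc p + t)) (sum-++ (map pred us) zs) ⟩
    (h + p) + (a ∸ suc p + (sum (map pred us) + sum zs))
      ≡⟨ lemma (length us) p (a ∸ suc p) (sum (map pred us)) (sum zs) ⟩
    (suc p + (a ∸ suc p)) + ((length us + sum (map pred us)) + sum zs)
      ≡⟨ cong₂ (λ s t → s + (t + sum zs)) (m+[n∸m]≡n star-fits) (sum-pred (All.tail positive)) ⟩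
    a + (sum us + sum zs)
      ≡⟨ cong (a +_) (sym (sum-++ us zs)) ⟩
    sum ns
      ≡⟨ Σns ⟩
    (h + p) + triangle (length us + p) ∎)
    where
    open ≡-Reasoning
    lemma : ∀ l p x y z → (suc l + p) + (x + (y + z)) ≡ (suc p + x) + ((l + y) + z)
    lemma = solve-∀

  -- Below a ∸ (p + 1) the large star is invisible to the caps; above it only the h − 1 entries
  -- of us can exceed the cap, and each does so by at most p.
  dominates-removed : Dominates (length us) ns'
  dominates-removed d = go p refl
    where
    open ≤-Reasoning
    go : ∀ q → p ≡ q → stair d (length us) ≤ cappedSum d ns'
    -- For p = 0 the hook takes one from each of the h largest entries, which is the case of
    -- `Dominates-pred`.
    go zero refl = subst (λ t → stair d (length us) ≤ cappedSum d (t ∷ map pred us ++ zs))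
      (pred[m∸n]≡m∸[1+n] a 0) (Dominates-pred (a ∷ us) top dom d)
    go (suc q) refl with d ≤? a ∸ suc p
    ... | yes d≤ = begin
      stair d (length us)
        ≤⟨ Dominates-pred (a ∷ us) top dom d ⟩
      pred a ⊓ d + cappedSum d (map pred us ++ zs)
        ≡⟨ cong (_+ cappedSum d (map pred us ++ zs))
             (trans (m≥n⇒m⊓n≡n d≤pred) (sym (m≥n⇒m⊓n≡n d≤))) ⟩
      (a ∸ suc p) ⊓ d + cappedSum d (map pred us ++ zs) ∎
      where
      d≤pred : d ≤ pred a
      d≤pred = ≤-trans d≤ (≤-trans (∸-monoʳ-≤ {1} {suc p} a (s≤s z≤n)) (≤-reflexive (sym (pred[m∸n]≡m∸[1+n] a 0))))
    -- The remaining total is at least `triangle (h − 1)` plus (h - 1) p, and the cap costs at most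
    -- (h - 1) p.
    ... | no d≰ = ≤-trans (stair≤triangle d (length us)) (+-cancelʳ-≤ (length us * p) _ _ (begin
      triangle (length us) + length us * p
        ≤⟨ m≤m+n _ (triangle p) ⟩
      triangle (length us) + length us * p + triangle p
        ≡⟨ sym (triangle-+ (length us) p) ⟩
      triangle (length us + p)
        ≡⟨ sym sum-removed ⟩
      (a ∸ suc p) + sum (map pred us ++ zs)
        ≡⟨ cong (a ∸ suc p +_) (sum-++ (map pred us) zs) ⟩
      (a ∸ suc p) + (sum (map pred us) + sum zs)
        ≤⟨ +-mono-≤ (≤-reflexive (sym (m≤n⇒m⊓n≡m (<⇒≤ (≰⇒> d≰)))))
             (+-mono-≤ (sum≤cappedSum+excess d p us-bound) (≤-reflexive (sym (cappedSum-all≤ zs≤d)))) ⟩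
      (a ∸ suc p) ⊓ d + ((cappedSum d (map pred us) + length (map pred us) * p) + cappedSum d zs)
        ≡⟨ cong (λ l → (a ∸ suc p) ⊓ d + ((cappedSum d (map pred us) + l * p) + cappedSum d zs))
             (length-map pred us) ⟩
      (a ∸ suc p) ⊓ d + ((cappedSum d (map pred us) + length us * p) + cappedSum d zs)
        ≡⟨ lemma ((a ∸ suc p) ⊓ d) (cappedSum d (map pred us)) (length us * p) (cappedSum d zs) ⟩
      ((a ∸ suc p) ⊓ d + (cappedSum d (map pred us) + cappedSum d zs)) + length us * p
        ≡⟨ cong (λ t → ((a ∸ suc p) ⊓ d + t) + length us * p) (sym (cappedSum-++ d (map pred us) zs)) ⟩
      cappedSum d ns' + length us * p ∎))
      where
      lemma : ∀ x y l z → x + ((y + l) + z) ≡ (x + (y + z)) + l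
      lemma = solve-∀

      a≤d+p : a ≤ d + p
      a≤d+p = begin
        a                        ≡⟨ sym (m+[n∸m]≡n star-fits) ⟩
        suc p + (a ∸ suc p)      ≡⟨ +-comm (suc p) _ ⟩
        a ∸ suc p + suc p        ≡⟨ +-suc _ p ⟩
        suc (a ∸ suc p) + p      ≤⟨ +-monoˡ-≤ p (≰⇒> d≰) ⟩
        d + p                    ∎

      us-bound : All (_≤ d + p) (map pred us)
      us-bound = All-map⁺ (All.map (λ u≤a → ≤-trans pred[n]≤n (≤-trans u≤a a≤d+p)) us≤a)

      c*<d : c* < d
      c*<d = ≤-<-trans (m+n≤o⇒m≤o∸n c* (large refl)) (≰⇒> d≰)

      -- An entry of zs above d exceeds `c*`, and by `top` so do all of `a ∷ us`: h + 1 entries, one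
      -- more than `few` allows.
      zs≤d : All (_≤ d) zs
      zs≤d = All.tabulate λ {z} z∈ → case z ≤? d of λ
        { (yes z≤d) → z≤d
        ; (no z≰d) → contradiction (too-many z∈ (<-trans c*<d (≰⇒> z≰d))) (<⇒≱ (s≤s few)) }
        where
        one-more : ∀ {z zs} → z ∈ zs → c* < z → 1 ≤ countAbove c* zs
        one-more (here refl) c*<z = ≤-trans (⊓-glb (s≤s z≤n) (m<n⇒0<n∸m c*<z)) (m≤m+n _ _)
        one-more (there z∈)  c*<z = ≤-trans (one-more z∈ c*<z) (m≤n+m _ _)

        too-many : ∀ {z} → z ∈ zs → c* < z → suc h ≤ countAbove c* ns
        too-many z∈ c*<z = begin
          suc h                                      ≡⟨ +-comm 1 h ⟩
          h + 1                                      ≤⟨ +-mono-≤ (≤-reflexive (sym (countAbove-all all-above))) (one-more z∈ c*<z) ⟩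
          countAbove c* (a ∷ us) + countAbove c* zs  ≡⟨ sym (trans (cong sum (map-++ (λ n → 1 ⊓ (n ∸ c*)) (a ∷ us) zs)) (sum-++ (map (λ n → 1 ⊓ (n ∸ c*)) (a ∷ us)) _)) ⟩
          countAbove c* ns                           ∎
          where
          all-above : All (c* <_) (a ∷ us)
          all-above = All.tabulate λ y∈ → <-≤-trans c*<z (top y∈ z∈)

-- Serving requests by distinct neighbours

module _ {A : Set} where

  Unique-↭ : ∀ {xs ys : List A} → xs ↭ ys → Unique xs → Unique ys
  Unique-↭ p = ↭ₛ.Unique-resp-↭ (setoid A) (↭⇒↭ₛ p)

  Unique-++ʳ : ∀ (xs : List A) {ys} → Unique (xs ++ ys) → Unique ys
  Unique-++ʳ []       u       = u
  Unique-++ʳ (x ∷ xs) (_ ∷ u) = Unique-++ʳ xs u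

  Unique-++ˡ : ∀ (xs : List A) {ys} → Unique (xs ++ ys) → Unique xs
  Unique-++ˡ []       u       = []
  Unique-++ˡ (x ∷ xs) (p ∷ u) = All-++⁻ˡ xs p ∷ Unique-++ˡ xs u

  Unique-++-disjoint : ∀ (xs : List A) {ys x} → Unique (xs ++ ys) → x ∈ xs → x ∉ ys
  Unique-++-disjoint (x ∷ xs) u       (here refl) x∈ys = Unique[x∷xs]⇒x∉xs u (∈-++⁺ʳ xs x∈ys)
  Unique-++-disjoint (x ∷ xs) (_ ∷ u) (there x∈)  x∈ys = Unique-++-disjoint xs u x∈ x∈ys

  take-length-++ : ∀ (xs ys : List A) → take (length xs) (xs ++ ys) ≡ xs
  take-length-++ []       ys = refl
  take-length-++ (x ∷ xs) ys = cong (x ∷_) (take-length-++ xs ys)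

  take-snoc : ∀ j (xs : List A) → j < length xs → ∃ λ x → take (suc j) xs ≡ take j xs ++ x ∷ []
  take-snoc zero    (x ∷ xs) lt       = x , refl
  take-snoc (suc j) (x ∷ xs) (s≤s lt) with y , eq ← take-snoc j xs lt = y , cong (x ∷_) eq

module Requests {V : Set} (_≟_ : DecidableEquality V) where
  open DecMembership _≟_ using (_∈?_)

  δ : V → V → ℕ
  δ x y = if does (x ≟ y) then 1 else 0

  δ-refl : ∀ x → δ x x ≡ 1
  δ-refl x rewrite dec-true (x ≟ x) refl = refl

  δ-≢ : ∀ {x y} → x ≢ y → δ x y ≡ 0
  δ-≢ {x} {y} x≢y rewrite dec-false (x ≟ y) x≢y = refl

  cnt : V → List V → ℕ
  cnt x ys = sum (map (δ x) ys)

  cnt-++ : ∀ x ys zs → cnt x (ys ++ zs) ≡ cnt x ys + cnt x zs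
  cnt-++ x ys zs = trans (cong sum (map-++ (δ x) ys zs)) (sum-++ (map (δ x) ys) _)

  cnt-↭ : ∀ x {ys zs} → ys ↭ zs → cnt x ys ≡ cnt x zs
  cnt-↭ x p = sum-↭ (↭-map⁺ (δ x) p)

  cnt-∉ : ∀ {x} ys → x ∉ ys → cnt x ys ≡ 0
  cnt-∉ []       x∉ = refl
  cnt-∉ (y ∷ ys) x∉ = cong₂ _+_ (δ-≢ (x∉ ∘ here)) (cnt-∉ ys (x∉ ∘ there))

  cnt-∈ : ∀ {x ys} → Unique ys → x ∈ ys → cnt x ys ≡ 1
  cnt-∈ {x} {_ ∷ ys} u (here refl) = cong₂ _+_ (δ-refl x) (cnt-∉ ys (Unique[x∷xs]⇒x∉xs u))
  cnt-∈ {x} {y ∷ ys} u@(_ ∷ u') (there x∈) =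
    cong₂ _+_ (δ-≢ λ { refl → Unique[x∷xs]⇒x∉xs u x∈ }) (cnt-∈ u' x∈)

  cnt-replicate : ∀ p x → cnt x (replicate p x) ≡ p
  cnt-replicate zero    x = refl
  cnt-replicate (suc p) x = cong₂ _+_ (δ-refl x) (cnt-replicate p x)

  ∈-replicate⁻ : ∀ p {x y : V} → x ∈ replicate p y → x ≡ y
  ∈-replicate⁻ (suc p) (here refl) = refl
  ∈-replicate⁻ (suc p) (there x∈)  = ∈-replicate⁻ p x∈

  -- The number of prefixes take 1 L, …, take n L that contain x.
  quota : ℕ → List V → V → ℕ
  quota n []       x = 0
  quota n (y ∷ ys) x = δ x y * n + quota (pred n) ys x

  quota-zero : ∀ L x → quota 0 L x ≡ 0
  quota-zero []       x = refl
  quota-zero (y ∷ ys) x = cong₂ _+_ (*-zeroʳ (δ x y)) (quota-zero ys x)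

  -- Splits off the longest prefix: removing a layer with left ends `take n L` turns the quota for n
  -- into the one for n - 1.
  quota-suc : ∀ n L x → quota n L x ≡ quota (pred n) L x + cnt x (take n L)
  quota-suc zero    L        x = sym (+-identityʳ _)
  quota-suc (suc n) []       x = refl
  quota-suc (suc n) (y ∷ ys) x rewrite quota-suc n ys x =
    lemma (δ x y) n (quota (pred n) ys x) (cnt x (take n ys))
    where
    lemma : ∀ d n a c → d * suc n + (a + c) ≡ d * n + a + (d + c)
    lemma = solve-∀

  quota-∉ : ∀ n {x} L → x ∉ L → quota n L x ≡ 0
  quota-∉ n []       x∉ = refl
  quota-∉ n (y ∷ ys) x∉ = cong₂ _+_ (cong (_* n) (δ-≢ (x∉ ∘ here))) (quota-∉ (pred n) ys (x∉ ∘ there))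

  -- For j from |L| + 1 to |L| + m the prefix is all of L. With m the size of the hook, this is the
  -- degree that the hook requests need.
  quota-∈ : ∀ m {L x} → x ∈ L → m ≤ quota (m + length L) L x
  quota-∈ m {y ∷ ys} {x} (here refl) rewrite δ-refl x | +-identityʳ (m + suc (length ys)) =
    ≤-trans (m≤m+n m _) (m≤m+n _ _)
  quota-∈ m {y ∷ ys} {x} (there x∈) rewrite +-suc m (length ys) =
    ≤-trans (quota-∈ m x∈) (m≤n+m _ _)

  -- Requests are served from the last to the first, so each one finds as many right ends
  -- occupied as there are entries after it.
  Feasible : (V → ℕ) → List V → Set
  Feasible d []       = ⊤
  Feasible d (x ∷ xs) = length xs < d x × Feasible d xs

  feasible-short : ∀ {d} m xs → length xs ≤ m → (∀ {x} → x ∈ xs → m ≤ d x) → Feasible d xs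
  feasible-short m []       le big = tt
  feasible-short m (x ∷ xs) le big =
    ≤-trans le (big (here refl)) , feasible-short m xs (<⇒≤ le) (big ∘ there)

  -- The whole list has length j, so the i-th vertex of L (from 0) is followed by j - i - 1
  -- requests, while its quota is at least j - i.
  feasible-prefix : ∀ {d} j L {X} → (∀ x → quota j L x ≤ d x) → length X ≡ j ∸ length L →
                    Feasible d X → Feasible d (take j L ++ X)
  feasible-prefix zero    L        q lenX f = f
  feasible-prefix (suc j) []       q lenX f = f
  feasible-prefix {d} (suc j) (y ∷ ys) {X} q lenX f =
      ≤-trans (s≤s (≤-reflexive len)) (≤-trans first (q y))
    , feasible-prefix j ys (λ x → ≤-trans (m≤n+m _ _) (q x)) lenX f
    where
    len : length (take j ys ++ X) ≡ j
    len rewrite length-++ (take j ys) {X} | length-take j ys | lenX | ⊓-comm j (length ys) = m⊓n+n∸m≡n (length ys) j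

    first : suc j ≤ quota (suc j) (y ∷ ys) y
    first rewrite δ-refl y | +-identityʳ j = m≤m+n _ _

  Edges : Set
  Edges = List (V × V)

  deg : Edges → V → ℕ
  deg E x = cnt x (map proj₁ E)

  -- Pigeonhole: each edge at x whose right end is occupied uses up one entry of us, and `Unique E`
  -- ensures that x does not meet that entry again.
  freshNeighbour : ∀ x (E : Edges) us → Unique E → length us < deg E x → ∃ λ b → (x , b) ∈ E × b ∉ us
  freshNeighbour x ((x' , b) ∷ E) us u@(_ ∷ u') lt with x ≟ x'
  ... | no _ with b' , ∈E , ∉us ← freshNeighbour x E us u' lt = b' , there ∈E , ∉us
  ... | yes refl with b ∈? us
  ...   | no b∉ = b , here refl , b∉
  ...   | yes b∈ with as , bs , refl ← ∈-∃++ b∈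
        with b' , ∈E , ∉us ← freshNeighbour x E (as ++ bs) u'
               (s≤s⁻¹ (subst (_< suc (deg E x)) (↭-length (shift b as bs)) lt)) =
    b' , there ∈E , λ b'∈ → case' (∈-resp-↭ (shift b as bs) b'∈)
    where
    case' : ¬ (b' ∈ b ∷ as ++ bs)
    case' (here refl) = Unique[x∷xs]⇒x∉xs u ∈E
    case' (there b'∈) = ∉us b'∈

  -- The neighbour is sought in all of E, so the degree bounds need no updating; an edge with a
  -- fresh right end cannot be among those already served.
  serve : ∀ (E : Edges) → Unique E → ∀ R → Feasible (deg E) R →
          ∃₂ λ es E' → E ↭ es ++ E' × map proj₁ es ≡ R × Unique (map proj₂ es)
  serve E u []       f        = [] , E , ↭-refl , refl , []
  serve E u (x ∷ xs) (lt , f)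
    with es , E' , p , refl , ues ← serve E u xs f
    with b , ∈E , b∉ ← freshNeighbour x E (map proj₂ es) u
           (subst (_< deg E x) (trans (length-map proj₁ es) (sym (length-map proj₂ es))) lt)
    with ∈-++⁻ es (∈-resp-↭ p ∈E)
  ... | inj₁ ∈es = contradiction (∈-map⁺ proj₂ ∈es) b∉
  ... | inj₂ ∈E' with as , bs , refl ← ∈-∃++ ∈E' =
    (x , b) ∷ es , as ++ bs , ↭-trans p perm , refl , All.tabulate (λ { y∈ refl → b∉ y∈ }) ∷ ues
    where
    perm : es ++ as ++ (x , b) ∷ bs ↭ (x , b) ∷ es ++ as ++ bs
    perm = ↭-trans (↭-reflexive (sym (++-assoc es as _)))
      (↭-trans (shift (x , b) (es ++ as) bs) (prep _ (↭-reflexive (++-assoc es as bs))))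

  -- Extending an injection by transpositions

  transposition : V → V → V → V
  transposition a b x with x ≟ a | x ≟ b
  ... | yes _ | _     = b
  ... | no _  | yes _ = a
  ... | no _  | no _  = x

  transposition-injective : ∀ a b → Injective _≡_ _≡_ (transposition a b)
  transposition-injective a b {x} {y} eq with x ≟ a | x ≟ b | y ≟ a | y ≟ b
  ... | yes p | _     | yes q | _     = trans p (sym q)
  ... | yes p | _     | no q  | yes r = trans p (trans (sym eq) (sym r))
  ... | yes p | _     | no q  | no r  = contradiction (sym eq) r
  ... | no p  | yes q | yes r | _     = trans q (trans (sym eq) (sym r))
  ... | no p  | yes q | no _  | yes r = trans q (sym r)
  ... | no p  | yes q | no r  | no _  = contradiction (sym eq) r
  ... | no p  | no q  | yes r | _     = contradiction eq q
  ... | no p  | no q  | no _  | yes r = contradiction eq p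
  ... | no p  | no q  | no _  | no r  = eq

  transposition-left : ∀ a b → transposition a b a ≡ b
  transposition-left a b with a ≟ a
  ... | yes _ = refl
  ... | no ≢  = contradiction refl ≢

  transposition-fixes : ∀ {a b x} → x ≢ a → x ≢ b → transposition a b x ≡ x
  transposition-fixes {a} {b} {x} x≢a x≢b with x ≟ a | x ≟ b
  ... | yes p | _     = contradiction p x≢a
  ... | no _  | yes q = contradiction q x≢b
  ... | no _  | no _  = refl

  -- Each pair is added by composing with the transposition of `φ u` and w. The two disjointness
  -- hypotheses keep both points off the images of fixed vertices, uniqueness keeps them off the
  -- pairs already placed. The result is injective on all of V, as `IsoToSubgraph` demands.
  extendInjection : ∀ {σ : V → V} → Injective _≡_ _≡_ σ → (Fixed : V → Set) →
    ∀ us ws → Unique us → Unique ws → length us ≡ length ws →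
    (∀ {u} → u ∈ us → ¬ Fixed u) → (∀ {x w} → Fixed x → w ∈ ws → σ x ≢ w) →
    ∃ λ φ → Injective _≡_ _≡_ φ × map φ us ≡ ws × (∀ {x} → Fixed x → φ x ≡ σ x)
  extendInjection {σ} inj Fixed [] [] _ _ _ _ _ = σ , inj , refl , λ _ → refl
  extendInjection inj Fixed (u ∷ us) (w ∷ ws) uu@(_ ∷ uus) uw@(_ ∷ uws) len free away
    with φ , φ-inj , φ-map , φ-fix ← extendInjection inj Fixed us ws uus uws (suc-injective len) (free ∘ there) (λ F → away F ∘ there) =
      transposition (φ u) w ∘ φ
    , φ-inj ∘ transposition-injective (φ u) w
    , cong₂ _∷_ (transposition-left (φ u) w) (trans (map-cong-local (All.tabulate fixes)) φ-map)
    , λ F → trans (transposition-fixes (λ eq → free (here refl) (subst Fixed (φ-inj eq) F))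
                    (λ eq → away F (here refl) (trans (sym (φ-fix F)) eq))) (φ-fix F)
    where
    fixes : ∀ {x} → x ∈ us → transposition (φ u) w (φ x) ≡ φ x
    fixes x∈ = transposition-fixes (λ eq → Unique[x∷xs]⇒x∉xs uu (subst (_∈ us) (φ-inj eq) x∈))
      (λ eq → Unique[x∷xs]⇒x∉xs uw (subst (w ∈_) φ-map (subst (_∈ map φ us) eq (∈-map⁺ φ x∈))))

  largest : ∀ (s : V → ℕ) x L → ∃₂ λ r L' → x ∷ L ↭ r ∷ L' × All (λ y → s y ≤ s r) L'
  largest s x [] = x , [] , ↭-refl , []
  largest s x (y ∷ L) with r , L' , p , all ← largest s y L with ≤-total (s x) (s r)
  ... | inj₁ x≤r = r , x ∷ L' , ↭-trans (prep x p) (swap x r ↭-refl) , x≤r ∷ all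
  ... | inj₂ r≤x = x , y ∷ L , ↭-refl , All-resp-↭ (↭-sym p) (r≤x ∷ All.map (λ y≤ → ≤-trans y≤ r≤x) all)

  -- The length is taken of `map s Y` so that matching it with `refl` puts the domination hypotheses
  -- into the form that `BuildHook` expects.
  largestFew : ∀ (s : V → ℕ) h L → h ≤ length L →
    ∃₂ λ Y Z → L ↭ Y ++ Z × length (map s Y) ≡ h × (∀ {y z} → y ∈ Y → z ∈ Z → s z ≤ s y)
  largestFew s zero    L       le = [] , L , ↭-refl , refl , λ ()
  largestFew s (suc h) (x ∷ L) le
    with r , L' , p , all ← largest s x L
    with Y , Z , q , len , top ← largestFew s h L' (s≤s⁻¹ (subst (suc h ≤_) (↭-length p) le)) =
    r ∷ Y , Z , ↭-trans p (prep r q) , cong suc len , λ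
      { (here refl) z∈ → All.lookup all (∈-resp-↭ (↭-sym q) (∈-++⁺ʳ Y z∈))
      ; (there y∈)  z∈ → top y∈ z∈ }

-- The columns of the decomposition

module HookColumns {V : Set} (_≟_ : DecidableEquality V) (L : List V) (L! : Unique L) where
  open Requests _≟_
  open DecMembership _≟_ using (_∈?_)

  -- Only left ends are compared. The relabelling keeps L but may move its vertices, because
  -- consecutive hooks can have different centres; r is the one additional left end.
  Ascends : List V → List V → Set
  Ascends R R' = ∃ λ (σ : V → V) → Injective _≡_ _≡_ σ × (∀ {x} → x ∈ L → σ x ∈ L) × ∃ λ r → R' ↭ r ∷ map σ R

  -- The last index records the left ends of the top layer, for comparison with the layer put above
  -- it.
  data Decomposition : ℕ → Edges → List V → Set where
    []    : Decomposition 0 [] []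
    layer : ∀ {n E R R'} es {E'} → E ↭ es ++ E' → map proj₁ es ≡ R' → length es ≡ suc n →
            Unique (map proj₂ es) → Ascends R R' → Decomposition n E' R → Decomposition (suc n) E R'

  deg-++ : ∀ {E} es {E' R} x → E ↭ es ++ E' → map proj₁ es ≡ R → deg E x ≡ cnt x R + deg E' x
  deg-++ {E} es {E'} x p refl = trans (cnt-↭ x (↭-map⁺ proj₁ p)) (trans (cong (cnt x) (map-++ proj₁ es E')) (cnt-++ x (map proj₁ es) _))

  noEdges : ∀ {E} → (∀ x → deg E x ≡ 0) → E ≡ []
  noEdges {[]}    d = refl
  noEdges {e ∷ E} d = contradiction (trans (sym (d (proj₁ e))) (cong (_+ deg E (proj₁ e)) (δ-refl (proj₁ e)))) λ ()

  -- Here no surplus is left: degrees equal quotas, and each layer extends the one below by a single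
  -- vertex under the identity relabelling.
  prefixPhase : ∀ j {E} → j ≤ length L → Unique E → (∀ x → deg E x ≡ quota j L x) → Decomposition j E (take j L)
  prefixPhase zero {E} j≤ E! d rewrite noEdges {E} (λ x → trans (d x) (quota-zero L x)) = []
  prefixPhase (suc j) {E} j≤ E! d
    with es , E' , p , req , es! ← serve E E! (take (suc j) L)
           (subst (Feasible (deg E)) (++-identityʳ _)
             (feasible-prefix (suc j) L {[]} (λ x → ≤-reflexive (sym (d x))) (sym (m≤n⇒m∸n≡0 j≤)) tt))
    with r , eq ← take-snoc j L j≤ =
    layer es p req
      (trans (sym (length-map proj₁ es)) (trans (cong length req) (trans (length-take (suc j) L) (m≤n⇒m⊓n≡m j≤))))
      es!
      (id , id , id , r , ↭-trans (↭-reflexive eq)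
        (↭-trans (++-comm (take j L) (r ∷ [])) (prep r (↭-reflexive (sym (map-id (take j L)))))))
      (prefixPhase j (<⇒≤ j≤) (Unique-++ʳ es (Unique-↭ p E!)) d')
    where
    d' : ∀ x → deg E' x ≡ quota j L x
    d' x = +-cancelˡ-≡ (cnt x (take (suc j) L)) _ _
      (trans (sym (deg-++ es x p req)) (trans (d x) (trans (quota-suc (suc j) L x) (+-comm (quota j L x) _))))

  -- The m + 1 surplus edges of one stage. `dom` and `fails` determine h; they are stored because
  -- the values of h in consecutive hooks are compared through them.
  record Hook (m : ℕ) (s : V → ℕ) : Set where
    field
      h p     : ℕ
      r       : V
      P       : List V
      1≤h     : 1 ≤ h
      h+p     : h + p ≡ suc m
      L↭rP    : L ↭ r ∷ P
      dom     : Dominates h (map s L)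
      fails   : Fails (suc h) (map s L)

    requests : List V
    requests = replicate p r ++ take h (r ∷ P)

    rest : V → ℕ
    rest x = s x ∸ cnt x requests

    field
      available : ∀ x → cnt x requests ≤ s x
      rest-sum  : sum (map rest L) ≡ triangle m
      rest-dom  : Dominates (pred h) (map rest L)

    h≤|L| : h ≤ length L
    h≤|L| = ≤-trans (Dominates-length (map s L) dom) (≤-reflexive (length-map s L))

    requests⊆L : ∀ {x} → x ∈ requests → x ∈ L
    requests⊆L x∈ with ∈-++⁻ (replicate p r) x∈
    ... | inj₁ x∈r rewrite ∈-replicate⁻ p x∈r = ∈-resp-↭ (↭-sym L↭rP) (here refl)
    ... | inj₂ x∈t = ∈-resp-↭ (↭-sym L↭rP) (take-⊆ h x∈t)
      where
      take-⊆ : ∀ n {xs : List V} {x} → x ∈ take n xs → x ∈ xs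
      take-⊆ (suc n) {_ ∷ _} (here refl) = here refl
      take-⊆ (suc n) {_ ∷ _} (there x∈)  = there (take-⊆ n x∈)

    length-requests : length requests ≡ suc m
    length-requests = begin
      length requests                                   ≡⟨ length-++ (replicate p r) ⟩
      length (replicate p r) + length (take h (r ∷ P))  ≡⟨ cong₂ _+_ (length-replicate p) (length-take h (r ∷ P)) ⟩
      p + h ⊓ length (r ∷ P)                            ≡⟨ cong (p +_) (m≤n⇒m⊓n≡m (≤-trans h≤|L| (≤-reflexive (↭-length L↭rP)))) ⟩
      p + h                                             ≡⟨ +-comm p h ⟩
      h + p                                             ≡⟨ h+p ⟩
      suc m                                             ∎
      where open ≡-Reasoning

  nonEmpty : ∀ (xs : List V) → 1 ≤ length xs → ∃₂ λ y ys → xs ≡ y ∷ ys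
  nonEmpty (y ∷ ys) _ = y , ys , refl

  module BuildHook (m : ℕ) (s : V → ℕ) (Σs : sum (map s L) ≡ triangle (suc m))
    (r : V) (Y Z : List V) (L↭ : L ↭ r ∷ Y ++ Z)
    (r-max : All (λ y → s y ≤ s r) Y)
    (top   : ∀ {y z} → y ∈ r ∷ Y → z ∈ Z → s z ≤ s y)
    (dom   : Dominates (suc (length (map s Y))) (map s L))
    (fails : Fails (2 + length (map s Y)) (map s L)) where

    k p : ℕ
    k = length (map s Y)
    p = m ∸ k

    -- The staircase has k + 1 ≤ m + 1 steps by `Dominates⇒≤`, so the truncated difference is exact.
    k+p : k + p ≡ m
    k+p = m+[n∸m]≡n (s≤s⁻¹ (Dominates⇒≤ {_} {suc m} (map s L) Σs dom))

    map↭ : ∀ (f : V → ℕ) → map f L ↭ f r ∷ map f Y ++ map f Z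
    map↭ f = ↭-trans (↭-map⁺ f L↭) (↭-reflexive (cong (f r ∷_) (map-++ f Y Z)))

    downward : ∀ {a b} → (∃ λ y → y ∈ r ∷ Y × a ≡ s y) → (∃ λ z → z ∈ Z × b ≡ s z) → b ≤ a
    downward (y , y∈ , refl) (z , z∈ , refl) = top y∈ z∈

    module HR = HookRemoval (s r) (map s Y) (map s Z) p
      (All-map⁺ r-max)
      (λ y∈ z∈ → downward (∈-map⁻ s {xs = r ∷ Y} y∈) (∈-map⁻ s z∈))
      (trans (sum-↭ (↭-sym (map↭ s))) (trans Σs (cong (triangle ∘ suc) (sym k+p))))
      (Dominates-↭ (map↭ s) dom)
      (Fails-↭ (map↭ s) fails)

    requests : List V
    requests = replicate p r ++ take (suc k) (r ∷ Y ++ Z)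

    requests≡ : requests ≡ replicate p r ++ r ∷ Y
    requests≡ = cong (λ t → replicate p r ++ r ∷ t)
      (trans (cong (λ l → take l (Y ++ Z)) (length-map s Y)) (take-length-++ Y Z))

    rYZ! : Unique (r ∷ Y ++ Z)
    rYZ! = Unique-↭ L↭ L!

    rY! : Unique (r ∷ Y)
    rY! = Unique-++ˡ (r ∷ Y) rYZ!

    cnt-requests : ∀ x → cnt x requests ≡ cnt x (replicate p r) + cnt x (r ∷ Y)
    cnt-requests x = trans (cong (cnt x) requests≡) (cnt-++ x (replicate p r) (r ∷ Y))

    cnt-r : cnt r requests ≡ suc p
    cnt-r = trans (cnt-requests r) (trans (cong₂ _+_ (cnt-replicate p r) (cnt-∈ rY! (here refl))) (+-comm p 1))

    cnt-≢r : ∀ {x} → x ≢ r → cnt x requests ≡ cnt x (r ∷ Y)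
    cnt-≢r {x} x≢r = trans (cnt-requests x)
      (cong (_+ cnt x (r ∷ Y)) (cnt-∉ (replicate p r) (λ x∈ → x≢r (∈-replicate⁻ p x∈))))

    cnt-Y : ∀ {y} → y ∈ Y → cnt y requests ≡ 1
    cnt-Y y∈ = trans (cnt-≢r λ { refl → Unique[x∷xs]⇒x∉xs rY! y∈ }) (cnt-∈ rY! (there y∈))

    cnt-other : ∀ {x} → x ∉ r ∷ Y → cnt x requests ≡ 0
    cnt-other x∉ = trans (cnt-≢r (x∉ ∘ here)) (cnt-∉ (r ∷ Y) x∉)

    available : ∀ x → cnt x requests ≤ s x
    available x with x ∈? (r ∷ Y)
    ... | yes (here refl) = ≤-trans (≤-reflexive cnt-r) HR.star-fits
    ... | yes (there y∈)  = ≤-trans (≤-reflexive (cnt-Y y∈)) (All.lookup (All.tail HR.positive) (∈-map⁺ s y∈))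
    ... | no  x∉          = ≤-trans (≤-reflexive (cnt-other x∉)) z≤n

    rest : V → ℕ
    rest x = s x ∸ cnt x requests

    rest↭ : map rest L ↭ HR.ns'
    rest↭ = ↭-trans (map↭ rest) (↭-reflexive
      (cong₂ _∷_ (cong (s r ∸_) cnt-r) (cong₂ _++_
        (trans (map-cong-local (All.tabulate λ {y} y∈ → trans (cong (s y ∸_) (cnt-Y y∈)) (sym (pred[m∸n]≡m∸[1+n] (s y) 0))))
               (map-∘ {g = pred} {f = s} Y))
        (map-cong-local (All.tabulate λ {z} z∈ → cong (s z ∸_) (cnt-other λ z∈rY → Unique-++-disjoint (r ∷ Y) rYZ! z∈rY z∈))))))

    result : Hook m s
    result = record
      { h = suc k ; p = p ; r = r ; P = Y ++ Z ; 1≤h = s≤s z≤n ; h+p = cong suc k+p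
      ; L↭rP = L↭ ; dom = dom ; fails = fails ; available = available
      ; rest-sum = trans (sum-↭ rest↭) (trans HR.sum-removed (cong triangle k+p))
      ; rest-dom = Dominates-↭ (↭-sym rest↭) HR.dominates-removed }

  hook : ∀ m s → sum (map s L) ≡ triangle (suc m) → Hook m s
  hook m s Σs with maximalStaircase {m} (map s L) Σs
  ... | suc h₀ , s≤s _ , dom , fails
    with x , xs , L≡ ← nonEmpty L (≤-trans (s≤s z≤n) (≤-trans (Dominates-length (map s L) dom) (≤-reflexive (length-map s L))))
    with r , L' , p↭ , r-max ← largest s x xs
    with Y , Z , q↭ , refl , top ← largestFew s h₀ L'
           (s≤s⁻¹ (≤-trans (Dominates-length (map s L) dom)
             (≤-reflexive (trans (length-map s L) (trans (cong length L≡) (↭-length p↭))))))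
    with r-max' ← All-resp-↭ q↭ r-max =
    BuildHook.result m s Σs r Y Z (↭-trans (↭-reflexive L≡) (↭-trans p↭ (prep r q↭)))
      (All-++⁻ˡ Y r-max')
      (λ { (here refl) z∈ → All.lookup r-max' (∈-++⁺ʳ Y z∈) ; (there y∈) z∈ → top y∈ z∈ })
      dom fails

  -- h + p = 1 with h ≥ 1 leaves a single edge at r, added to the layer L below.
  ascends-first : ∀ {s} (H : Hook 0 s) → Ascends L (L ++ Hook.requests H)
  ascends-first H with Hook.h H | Hook.p H | Hook.1≤h H | Hook.h+p H
  ... | suc zero | zero | _ | refl = id , id , id , Hook.r H ,
    ↭-trans (++-comm L (Hook.r H ∷ [])) (prep _ (↭-reflexive (sym (map-id L))))

  module _ {m s} (H : Hook (suc m) s) (H' : Hook m (Hook.rest H)) where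

    private
      module H  = Hook H
      module H' = Hook H'

    -- Surpluses only decrease, so domination by a longer staircase after the removal would already
    -- have held before it.
    h'≤h : H'.h ≤ H.h
    h'≤h with H'.h ≤? H.h
    ... | yes h'≤h = h'≤h
    ... | no  h'≰h = contradiction
      (λ c → ≤-trans (Dominates-antitone (map H.rest L) (≰⇒> h'≰h) H'.dom c) (shrink c L))
      (Fails⇒¬Dominates (map s L) H.fails)
      where
      shrink : ∀ c xs → cappedSum c (map H.rest xs) ≤ cappedSum c (map s xs)
      shrink c []       = z≤n
      shrink c (x ∷ xs) = +-mono-≤ (⊓-monoˡ-≤ c (m∸n≤m (s x) (cnt x H.requests))) (shrink c xs)

    -- The rest dominates the staircase of `H.h` - 1 steps but not the one of `H'.h` + 1 steps.
    h≤1+h' : H.h ≤ suc H'.h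
    h≤1+h' with H.h ≤? suc H'.h
    ... | yes h≤ = h≤
    ... | no  h≰ = contradiction
      (Dominates-antitone (map H.rest L) (pred-mono-≤ (≰⇒> h≰)) H.rest-dom)
      (Fails⇒¬Dominates (map H.rest L) H'.fails)

    -- The relabelling matches the two orderings of L entry by entry, centre to centre. As
    -- `H.h + H.p` exceeds `H'.h + H'.p` by one, the extra left end is another copy of the centre if
    -- the two h agree, and otherwise the next vertex of `H.r ∷ H.P`.
    ascends-hook : Ascends (L ++ H'.requests) (L ++ H.requests)
    ascends-hook
      with σ , σ-inj , σ-map , _ ← extendInjection {id} id (λ _ → ⊥) (H'.r ∷ H'.P) (H.r ∷ H.P)
             (Unique-↭ H'.L↭rP L!) (Unique-↭ H.L↭rP L!)
             (trans (↭-length (↭-sym H'.L↭rP)) (↭-length H.L↭rP)) (λ _ ()) (λ ())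
      = σ , σ-inj , σ-L , grow (m≤n⇒m<n∨m≡n h'≤h)
      where
      σL↭L : map σ L ↭ L
      σL↭L = ↭-trans (↭-map⁺ σ H'.L↭rP) (↭-trans (↭-reflexive σ-map) (↭-sym H.L↭rP))

      σ-L : ∀ {x} → x ∈ L → σ x ∈ L
      σ-L x∈ = ∈-resp-↭ σL↭L (∈-map⁺ σ x∈)

      σ-requests : map σ H'.requests ≡ replicate H'.p H.r ++ take H'.h (H.r ∷ H.P)
      σ-requests = begin
        map σ (replicate H'.p H'.r ++ take H'.h (H'.r ∷ H'.P))
          ≡⟨ map-++ σ (replicate H'.p H'.r) _ ⟩
        map σ (replicate H'.p H'.r) ++ map σ (take H'.h (H'.r ∷ H'.P))
          ≡⟨ cong₂ _++_ (map-replicate σ H'.p H'.r) (sym (take-map H'.h (H'.r ∷ H'.P))) ⟩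
        replicate H'.p (σ H'.r) ++ take H'.h (map σ (H'.r ∷ H'.P))
          ≡⟨ cong₂ (λ r P → replicate H'.p r ++ take H'.h P) (proj₁ (∷-injective σ-map)) σ-map ⟩
        replicate H'.p H.r ++ take H'.h (H.r ∷ H.P) ∎
        where open ≡-Reasoning

      σ-all : map σ (L ++ H'.requests) ↭ L ++ replicate H'.p H.r ++ take H'.h (H.r ∷ H.P)
      σ-all = ↭-trans (↭-reflexive (map-++ σ L _)) (++⁺ σL↭L (↭-reflexive σ-requests))

      insert : ∀ z → L ++ H.requests ↭ z ∷ L ++ replicate H'.p H.r ++ take H'.h (H.r ∷ H.P) →
               ∃ λ r → L ++ H.requests ↭ r ∷ map σ (L ++ H'.requests)
      insert z p = z , ↭-trans p (prep z (↭-sym σ-all))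

      grow : H'.h < H.h ⊎ H'.h ≡ H.h → ∃ λ r → L ++ H.requests ↭ r ∷ map σ (L ++ H'.requests)
      grow (inj₂ h'≡h) = insert H.r (↭-trans
        (↭-reflexive (cong₂ (λ p h → L ++ replicate p H.r ++ take h (H.r ∷ H.P)) p≡ (sym h'≡h)))
        (shift H.r L _))
        where
        p≡ : H.p ≡ suc H'.p
        p≡ = +-cancelˡ-≡ H.h _ _ (trans H.h+p (trans (cong suc (trans (sym H'.h+p) (cong (_+ H'.p) h'≡h))) (sym (+-suc H.h H'.p))))
      grow (inj₁ h'<h) with z , eq ← take-snoc H'.h (H.r ∷ H.P)
                               (≤-trans h'<h (≤-trans H.h≤|L| (≤-reflexive (↭-length H.L↭rP)))) =
        insert z (↭-trans (↭-reflexive (trans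
            (cong₂ (λ p h → L ++ replicate p H.r ++ take h (H.r ∷ H.P)) p≡ h≡)
            (cong (λ t → L ++ replicate H'.p H.r ++ t) eq)))
          (↭-trans (++⁺ˡ L (++⁺ˡ (replicate H'.p H.r) (++-comm _ (z ∷ []))))
            (↭-trans (++⁺ˡ L (shift z (replicate H'.p H.r) _)) (shift z L _))))
        where
        h≡ : H.h ≡ suc H'.h
        h≡ = ≤-antisym h≤1+h' h'<h
        p≡ : H.p ≡ H'.p
        p≡ = +-cancelˡ-≡ H.h _ _ (trans H.h+p (trans (cong suc (sym H'.h+p)) (cong (_+ H'.p) (sym h≡))))

  -- Carried through `hookPhase` because the layer above is compared with the whole hook below, not
  -- only with its left ends.
  Shape : ℕ → (V → ℕ) → List V → Set
  Shape zero    s R = R ≡ L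
  Shape (suc m) s R = ∃ λ (H : Hook m s) → R ≡ L ++ Hook.requests H

  ascends-from : ∀ m {s} (H : Hook m s) {R} → Shape m (Hook.rest H) R → Ascends R (L ++ Hook.requests H)
  ascends-from zero    H refl        = ascends-first H
  ascends-from (suc m) H (H' , refl) = ascends-hook H H'

  module HookLayer {m : ℕ} {s : V → ℕ} (H : Hook m s) (E : Edges)
    (d : ∀ x → deg E x ≡ quota (suc m + length L) L x + s x) where

    module H = Hook H

    take-L : take (suc m + length L) L ≡ L
    take-L = take-all (suc m + length L) L (m≤n+m (length L) (suc m))

    quota≤deg : ∀ x → quota (suc m + length L) L x ≤ deg E x
    quota≤deg x = ≤-trans (m≤m+n (quota (suc m + length L) L x) (s x)) (≤-reflexive (sym (d x)))

    -- The hook stands last in the list and is served first; each of its vertices has degree at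
    -- least m + 1, the number of its requests.
    feasible : Feasible (deg E) (L ++ H.requests)
    feasible = subst (λ t → Feasible (deg E) (t ++ H.requests)) take-L
      (feasible-prefix (suc m + length L) L quota≤deg
        (trans H.length-requests (sym (m+n∸n≡m (suc m) (length L))))
        (feasible-short (suc m) H.requests (≤-reflexive H.length-requests)
          (λ x∈ → ≤-trans (quota-∈ (suc m) (H.requests⊆L x∈)) (quota≤deg _))))

    len : ∀ (es : Edges) → map proj₁ es ≡ L ++ H.requests → length es ≡ suc (m + length L)
    len es req = begin
      length es                    ≡⟨ sym (length-map proj₁ es) ⟩
      length (map proj₁ es)        ≡⟨ cong length req ⟩
      length (L ++ H.requests)     ≡⟨ length-++ L ⟩
      length L + length H.requests ≡⟨ cong (length L +_) H.length-requests ⟩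
      length L + suc m             ≡⟨ +-comm (length L) (suc m) ⟩
      suc m + length L             ∎
      where open ≡-Reasoning

    -- The copy of L comes off the quota, the hook off the surplus.
    remaining : ∀ es {E'} → E ↭ es ++ E' → map proj₁ es ≡ L ++ H.requests →
         ∀ x → deg E' x ≡ quota (m + length L) L x + H.rest x
    remaining es {E'} p req x = +-cancelˡ-≡ (cnt x L + cnt x H.requests) _ _ (begin
      cnt x L + cnt x H.requests + deg E' x
        ≡⟨ cong (_+ deg E' x) (sym (cnt-++ x L H.requests)) ⟩
      cnt x (L ++ H.requests) + deg E' x
        ≡⟨ sym (deg-++ es x p req) ⟩
      deg E x
        ≡⟨ d x ⟩
      quota (suc m + length L) L x + s x
        ≡⟨ cong₂ _+_ (quota-suc (suc m + length L) L x) (sym (m+[n∸m]≡n (H.available x))) ⟩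
      quota (m + length L) L x + cnt x (take (suc m + length L) L) + (cnt x H.requests + H.rest x)
        ≡⟨ cong (λ t → quota (m + length L) L x + cnt x t + (cnt x H.requests + H.rest x)) take-L ⟩
      quota (m + length L) L x + cnt x L + (cnt x H.requests + H.rest x)
        ≡⟨ lemma (quota (m + length L) L x) (cnt x L) (cnt x H.requests) (H.rest x) ⟩
      cnt x L + cnt x H.requests + (quota (m + length L) L x + H.rest x) ∎)
      where
      open ≡-Reasoning
      lemma : ∀ q a b c → q + a + (b + c) ≡ a + b + (q + c)
      lemma = solve-∀

    outside' : (∀ {x} → x ∉ L → s x ≡ 0) → ∀ {x} → x ∉ L → H.rest x ≡ 0
    outside' outside x∉ = trans (cong (_∸ cnt _ H.requests) (outside x∉)) (0∸n≡0 (cnt _ H.requests))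

  vanishes : ∀ s → (∀ {x} → x ∉ L → s x ≡ 0) → sum (map s L) ≡ 0 → ∀ x → s x ≡ 0
  vanishes s outside Σs x with x ∈? L
  ... | yes x∈ = go L Σs x∈
    where
    go : ∀ xs → sum (map s xs) ≡ 0 → ∀ {x} → x ∈ xs → s x ≡ 0
    go (x ∷ xs) eq (here refl) = m+n≡0⇒m≡0 (s x) eq
    go (x ∷ xs) eq (there x∈)  = go xs (m+n≡0⇒n≡0 (s x) eq) x∈
  ... | no  x∉ = outside x∉

  hookPhase : ∀ m {E} s → Unique E → (∀ x → deg E x ≡ quota (m + length L) L x + s x) →
              (∀ {x} → x ∉ L → s x ≡ 0) → sum (map s L) ≡ triangle m →
              ∃ λ R → Decomposition (m + length L) E R × Shape m s R
  hookPhase zero {E} s E! d outside Σs =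
    L , subst (Decomposition _ _) (take-all (length L) L ≤-refl) (prefixPhase (length L) {E} ≤-refl E! d') , refl
    where
    d' : ∀ x → deg E x ≡ quota (length L) L x
    d' x = trans (d x) (trans (cong (quota (length L) L x +_) (vanishes s outside Σs x)) (+-identityʳ _))
  hookPhase (suc m) {E} s E! d outside Σs
    with H ← hook m s Σs
    with es , E' , p , req , es! ← serve E E! (L ++ Hook.requests H) (HookLayer.feasible H E d)
    with R , D , shape ← hookPhase m {E'} (Hook.rest H) (Unique-++ʳ es (Unique-↭ p E!))
           (HookLayer.remaining H E d es p req) (λ {x} → HookLayer.outside' H E d outside {x}) (Hook.rest-sum H) =
    L ++ Hook.requests H , layer es p req (HookLayer.len H E d es req) es! (ascends-from m H shape) D , H , refl

  decompose : ∀ n {E} s → Unique E → (∀ x → deg E x ≡ quota n L x + s x) →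
              (∀ {x} → x ∉ L → s x ≡ 0) → sum (map s L) ≡ triangle (n ∸ length L) → ∃ (Decomposition n E)
  decompose n {E} s E! d outside Σs with length L ≤? n
  -- With |L| > n the prescribed total is `triangle 0`, so the surplus vanishes and no hooks occur.
  ... | no  L≰n = take n L , prefixPhase n (≰⇒≥ L≰n) E! λ x → trans (d x)
        (trans (cong (quota n L x +_) (vanishes s outside (trans Σs (cong triangle (m≤n⇒m∸n≡0 (≰⇒≥ L≰n)))) x)) (+-identityʳ _))
  ... | yes L≤n with R , D , _ ← hookPhase (n ∸ length L) {E} s E!
                        (λ x → trans (d x) (cong (λ n → quota n L x + s x) (sym (m∸n+n≡m L≤n)))) (λ {x} → outside {x}) Σs =
        R , subst (λ n → Decomposition n E R) (m∸n+n≡m L≤n) D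

-- From edge lists to labelled graphs

triangle≡C : ∀ n → suc n C 2 ≡ triangle n
triangle≡C zero    = refl
triangle≡C (suc n) = trans (sym (nCk+nC[k+1]≡[n+1]C[k+1] (suc n) 1)) (cong₂ _+_ (nC1≡n (suc n)) (triangle≡C n))

∧-true : ∀ {a b} → a ∧ b ≡ true → a ≡ true × b ≡ true
∧-true {true} {true} refl = refl , refl

⌊⌋-true : ∀ {P : Set} (d : Dec P) → P → ⌊ d ⌋ ≡ true
⌊⌋-true (yes _) p = refl
⌊⌋-true (no ¬p) p = contradiction p ¬p

true-⌊⌋ : ∀ {P : Set} (d : Dec P) → ⌊ d ⌋ ≡ true → P
true-⌊⌋ (yes p) _ = p

≢true⇒false : ∀ {b} → true ≢ b → b ≡ false
≢true⇒false {false} _  = refl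
≢true⇒false {true}  t≢ = contradiction refl t≢

≢false⇒true : ∀ {b} → false ≢ b → b ≡ true
≢false⇒true {true}  _  = refl
≢false⇒true {false} f≢ = contradiction refl f≢

true≢false : ∀ {b} → b ≡ true → b ≢ false
true≢false refl ()

module _ {A : Set} where

  ∈-filterᵇ⁺ : ∀ (p : A → Bool) {x xs} → x ∈ xs → p x ≡ true → x ∈ filterᵇ p xs
  ∈-filterᵇ⁺ p x∈ px = ∈-filter⁺ (T? ∘ p) x∈ (Equivalence.from T-≡ px)

  ∈-filterᵇ⁻ : ∀ (p : A → Bool) {x xs} → x ∈ filterᵇ p xs → x ∈ xs × p x ≡ true
  ∈-filterᵇ⁻ p {x} {xs} x∈ with x∈xs , px ← ∈-filter⁻ (T? ∘ p) {xs = xs} x∈ = x∈xs , Equivalence.to T-≡ px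

  Unique-filterᵇ : ∀ (p : A → Bool) {xs} → Unique xs → Unique (filterᵇ p xs)
  Unique-filterᵇ p = filter⁺ (T? ∘ p)

  sameElements⇒↭ : ∀ {xs ys : List A} → Unique xs → Unique ys →
                   (∀ {x} → x ∈ xs → x ∈ ys) → (∀ {x} → x ∈ ys → x ∈ xs) → xs ↭ ys
  sameElements⇒↭ xs! ys! to from = ∼bag⇒↭ (unique∧set⇒bag xs! ys! (mk⇔ to from))

Unique-map-on : ∀ {A B : Set} (f : A → B) {xs} → Unique xs →
                (∀ {x y} → x ∈ xs → y ∈ xs → f x ≡ f y → x ≡ y) → Unique (map f xs)
Unique-map-on f {[]}     u inj = []
Unique-map-on f {x ∷ xs} xs!@(_ ∷ u) inj =
  All.tabulate (λ y∈ eq → distinct (∈-map⁻ f y∈) eq) ∷ Unique-map-on f u (λ a b → inj (there a) (there b))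
  where
  distinct : ∀ {b} → (∃ λ y → y ∈ xs × b ≡ f y) → f x ≢ b
  distinct (y , y∈ , refl) eq = Unique[x∷xs]⇒x∉xs xs! (subst (_∈ xs) (sym (inj (here refl) (there y∈) eq)) y∈)

concatMap-cartesian : ∀ {A B : Set} (xs : List A) (ys : List B) →
                      concatMap (λ x → map (x ,_) ys) xs ≡ cartesianProduct xs ys
concatMap-cartesian []       ys = refl
concatMap-cartesian (x ∷ xs) ys = cong (map (x ,_) ys ++_) (concatMap-cartesian xs ys)

∈-pairs : ∀ {v} (e : Fin v × Fin v) → e ∈ pairs v
∈-pairs {v} (x , y) = subst ((x , y) ∈_) (sym (concatMap-cartesian (allFin v) (allFin v)))
  (∈-cartesianProduct⁺ (∈-allFin x) (∈-allFin y))

pairs! : ∀ v → Unique (pairs v)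
pairs! v = subst Unique (sym (concatMap-cartesian (allFin v) (allFin v))) (cartesianProduct⁺ (allFin⁺ v) (allFin⁺ v))

-- Counting edges from one colour class

module _ {v} (c : Fin v → Bool) where

  orient : Fin v × Fin v → Fin v × Fin v
  orient (x , y) with c x
  ... | true  = x , y
  ... | false = y , x

  orient-cases : ∀ e → orient e ≡ e ⊎ orient e ≡ ×-swap e
  orient-cases (x , y) with c x
  ... | true  = inj₁ refl
  ... | false = inj₂ refl

  orient-true : ∀ {x} y → c x ≡ true → orient (x , y) ≡ (x , y)
  orient-true y eq rewrite eq = refl

  orient-false : ∀ {x} y → c x ≡ false → orient (x , y) ≡ (y , x)
  orient-false y eq rewrite eq = refl

  -- `numEdgesRel` lists each edge with its smaller index first, es with its coloured end first;
  -- `orient` is a bijection between the two lists.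
  numEdgesRel-length : (r : Fin v → Fin v → Bool) → (∀ x y → r x y ≡ r y x) →
    (∀ {x y} → r x y ≡ true → c x ≢ c y) → ∀ {es} → Unique es →
    (∀ {x y} → c x ≡ true → r x y ≡ true → (x , y) ∈ es) →
    (∀ {x y} → (x , y) ∈ es → c x ≡ true × r x y ≡ true) →
    numEdgesRel r ≡ length es
  numEdgesRel-length r r-sym proper {es} es! into outof =
    trans (sym (length-map orient low)) (↭-length (sameElements⇒↭
      (Unique-map-on orient (Unique-filterᵇ test (pairs! v)) orient-inj) es!
      (λ e∈ → to (∈-map⁻ orient e∈)) from))
    where
    test : Fin v × Fin v → Bool
    test (x , y) = (x <ᵇᶠ y) ∧ r x y

    low : List (Fin v × Fin v)
    low = filterᵇ test (pairs v)

    low⁻ : ∀ {x y} → (x , y) ∈ low → toℕ x < toℕ y × r x y ≡ true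
    low⁻ {x} {y} e∈ with lt , rxy ← ∧-true {x <ᵇᶠ y} (proj₂ (∈-filterᵇ⁻ test {xs = pairs v} e∈)) =
      true-⌊⌋ (toℕ x <? toℕ y) lt , rxy

    low⁺ : ∀ {x y} → toℕ x < toℕ y → r x y ≡ true → (x , y) ∈ low
    low⁺ {x} {y} lt rxy = ∈-filterᵇ⁺ test (∈-pairs (x , y)) (cong₂ _∧_ (⌊⌋-true (toℕ x <? toℕ y) lt) rxy)

    flipped : ∀ {e e'} → e ∈ low → e' ∈ low → e ≢ ×-swap e'
    flipped e∈ e'∈ refl = <-asym (proj₁ (low⁻ e∈)) (proj₁ (low⁻ e'∈))

    orient-inj : ∀ {e e'} → e ∈ low → e' ∈ low → orient e ≡ orient e' → e ≡ e'
    orient-inj {e} {e'} e∈ e'∈ eq with orient-cases e | orient-cases e'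
    ... | inj₁ p | inj₁ q = trans (sym p) (trans eq q)
    ... | inj₁ p | inj₂ q = contradiction (trans (sym p) (trans eq q)) (flipped e∈ e'∈)
    ... | inj₂ p | inj₁ q = contradiction (trans (sym q) (trans (sym eq) p)) (flipped e'∈ e∈)
    ... | inj₂ p | inj₂ q = cong ×-swap (trans (sym p) (trans eq q))

    to : ∀ {e} → (∃ λ e' → e' ∈ low × e ≡ orient e') → e ∈ es
    to ((x , y) , e∈ , refl) with low⁻ e∈ | c x in cx
    ... | _ , rxy | true  = into cx rxy
    ... | _ , rxy | false = into (≢false⇒true (subst (_≢ c y) cx (proper rxy))) (trans (r-sym y x) rxy)

    from : ∀ {e} → e ∈ es → e ∈ map orient low
    from {x , y} e∈ with cx , rxy ← outof e∈ | <-cmp (toℕ x) (toℕ y)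
    ... | tri< lt _ _ = subst (_∈ map orient low) (orient-true y cx) (∈-map⁺ orient (low⁺ lt rxy))
    ... | tri≈ _ eq _ = contradiction (cong c (toℕ-injective eq)) (proper rxy)
    ... | tri> _ _ gt = subst (_∈ map orient low)
      (orient-false x (≢true⇒false (subst (_≢ c y) cx (proper rxy))))
      (∈-map⁺ orient (low⁺ gt (trans (r-sym y x) rxy)))

-- The degree condition as a bound on quotas

module Ranking {v : ℕ} where
  open Requests {Fin v} _≟ᶠ_

  -- The degree condition read from the top degree downwards; `pred` stops at 0, so nothing is
  -- demanded from position n on.
  RankCondition : ℕ → (Fin v → ℕ) → List (Fin v) → Set
  RankCondition n d []       = ⊤
  RankCondition n d (y ∷ ys) = n ≤ d y × RankCondition (pred n) d ys

  rank-snoc : ∀ n {d} L {x} → RankCondition n d L → n ∸ length L ≤ d x → RankCondition n d (L ++ x ∷ [])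
  rank-snoc n []       rc         le = le , tt
  rank-snoc n (y ∷ ys) (le' , rc) le = le' , rank-snoc (pred n) ys rc (≤-trans (≤-reflexive (pred-∸ n (length ys))) le)
    where
    pred-∸ : ∀ n l → pred n ∸ l ≡ n ∸ suc l
    pred-∸ zero    l = 0∸n≡0 l
    pred-∸ (suc n) l = refl

  degreeCondition⇒rank : ∀ n {d} L → DegreeCondition n (map d L) → RankCondition n d (reverse L)
  degreeCondition⇒rank n []       dc = tt
  degreeCondition⇒rank n {d} (x ∷ xs) dc rewrite unfold-reverse x xs =
    rank-snoc n (reverse xs) (degreeCondition⇒rank n xs (dc ∘ fsuc))
      (≤-trans (≤-reflexive (cong (n ∸_) (trans (↭-length (↭-reverse xs)) (sym (length-map d xs))))) (dc fzero))

  rank⇒quota≤ : ∀ n {d} L → Unique L → RankCondition n d L → ∀ x → quota n L x ≤ d x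
  rank⇒quota≤ n []       _          _         x = z≤n
  rank⇒quota≤ n (y ∷ ys) ys!@(_ ∷ u) (le , rc) x with x ≟ᶠ y
  ... | no  _    = rank⇒quota≤ (pred n) ys u rc x
  ... | yes refl rewrite quota-∉ (pred n) ys (Unique[x∷xs]⇒x∉xs ys!) | +-identityʳ n | +-identityʳ n = le

  -- The prefixes `take j L` with j ≤ n have min(j, |L|) entries, so together they miss 1 + ... + (n
  -- ∸ |L|) of `triangle n`. Hence the surplus is triangular.
  quota-sum : ∀ n L → Unique L → sum (map (quota n L) L) + triangle (n ∸ length L) ≡ triangle n
  quota-sum n []       _           = refl
  quota-sum n (y ∷ ys) ys!@(_ ∷ u) = begin
    δ y y * n + quota (pred n) ys y + sum (map (quota n (y ∷ ys)) ys) + triangle (n ∸ suc (length ys))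
      ≡⟨ cong₂ (λ a b → a + b + triangle (n ∸ suc (length ys))) first (cong sum (map-cong-local (All.tabulate others))) ⟩
    n + sum (map (quota (pred n) ys) ys) + triangle (n ∸ suc (length ys))
      ≡⟨ peel n ⟩
    triangle n ∎
    where
    open ≡-Reasoning
    y∉ : y ∉ ys
    y∉ = Unique[x∷xs]⇒x∉xs ys!

    first : δ y y * n + quota (pred n) ys y ≡ n
    first rewrite δ-refl y | quota-∉ (pred n) ys y∉ | +-identityʳ n = +-identityʳ n

    others : ∀ {x} → x ∈ ys → quota n (y ∷ ys) x ≡ quota (pred n) ys x
    others {x} x∈ = cong (λ t → t * n + quota (pred n) ys x) (δ-≢ {x} {y} λ { refl → y∉ x∈ })

    peel : ∀ n → n + sum (map (quota (pred n) ys) ys) + triangle (n ∸ suc (length ys)) ≡ triangle n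
    peel zero    = trans (cong (λ l → sum (map (quota 0 ys) ys) + triangle l) (sym (0∸n≡0 (length ys)))) (quota-sum 0 ys u)
    peel (suc n) = trans (+-assoc (suc n) _ _) (cong (suc n +_) (quota-sum n ys u))

  module _ (N : Fin v → List (Fin v)) where

    edgesFrom : List (Fin v) → Edges
    edgesFrom []       = []
    edgesFrom (y ∷ ys) = map (y ,_) (N y) ++ edgesFrom ys

    edgesFrom⁺ : ∀ {ys x b} → x ∈ ys → b ∈ N x → (x , b) ∈ edgesFrom ys
    edgesFrom⁺ (here refl)       b∈ = ∈-++⁺ˡ (∈-map⁺ (_ ,_) b∈)
    edgesFrom⁺ {y ∷ ys} (there x∈) b∈ = ∈-++⁺ʳ (map (y ,_) (N y)) (edgesFrom⁺ x∈ b∈)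

    edgesFrom⁻ : ∀ ys {x b} → (x , b) ∈ edgesFrom ys → x ∈ ys × b ∈ N x
    edgesFrom⁻ (y ∷ ys) e∈ with ∈-++⁻ (map (y ,_) (N y)) e∈
    ... | inj₂ e∈' with x∈ , b∈ ← edgesFrom⁻ ys e∈' = there x∈ , b∈
    ... | inj₁ e∈' with _ , b∈ , refl ← ∈-map⁻ (y ,_) e∈' = here refl , b∈

    edgesFrom! : ∀ {ys} → (∀ x → Unique (N x)) → Unique ys → Unique (edgesFrom ys)
    edgesFrom! {[]}     N! _           = []
    edgesFrom! {y ∷ ys} N! ys!@(_ ∷ u) = Unique-++⁺ (Unique-map⁺ ,-injectiveʳ (N! y)) (edgesFrom! N! u) disjoint
      where
      disjoint : ∀ {e} → ¬ (e ∈ map (y ,_) (N y) × e ∈ edgesFrom ys)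
      disjoint (e∈ , e∈') with _ , _ , refl ← ∈-map⁻ (y ,_) e∈ =
        Unique[x∷xs]⇒x∉xs ys! (proj₁ (edgesFrom⁻ ys e∈'))

    edgesFrom-length : ∀ ys → length (edgesFrom ys) ≡ sum (map (length ∘ N) ys)
    edgesFrom-length []       = refl
    edgesFrom-length (y ∷ ys) = trans (length-++ (map (y ,_) (N y)))
      (cong₂ _+_ (length-map (y ,_) (N y)) (edgesFrom-length ys))

    edgesFrom-deg : ∀ ys x → deg (edgesFrom ys) x ≡ cnt x ys * length (N x)
    edgesFrom-deg []       x = refl
    edgesFrom-deg (y ∷ ys) x = begin
      deg (map (y ,_) (N y) ++ edgesFrom ys) x
        ≡⟨ cong (cnt x) (map-++ proj₁ (map (y ,_) (N y)) _) ⟩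
      cnt x (map proj₁ (map (y ,_) (N y)) ++ map proj₁ (edgesFrom ys))
        ≡⟨ cnt-++ x (map proj₁ (map (y ,_) (N y))) _ ⟩
      deg (map (y ,_) (N y)) x + deg (edgesFrom ys) x
        ≡⟨ cong₂ _+_ (trans (star (N y)) (at-x (x ≟ᶠ y))) (edgesFrom-deg ys x) ⟩
      δ x y * length (N x) + cnt x ys * length (N x)
        ≡⟨ sym (*-distribʳ-+ (length (N x)) (δ x y) (cnt x ys)) ⟩
      cnt x (y ∷ ys) * length (N x) ∎
      where
      open ≡-Reasoning
      star : ∀ bs → deg (map (y ,_) bs) x ≡ δ x y * length bs
      star []       = sym (*-zeroʳ (δ x y))
      star (b ∷ bs) = trans (cong (δ x y +_) (star bs)) (sym (*-suc (δ x y) (length bs)))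

      at-x : Dec (x ≡ y) → δ x y * length (N y) ≡ δ x y * length (N x)
      at-x (yes refl) = refl
      at-x (no  x≢y)  = trans (cong (_* length (N y)) (δ-≢ x≢y)) (sym (cong (_* length (N x)) (δ-≢ x≢y)))

-- The layer of an edge

module Layers {v : ℕ} (L : List (Fin v)) (L! : Unique L) where
  open Requests {Fin v} _≟ᶠ_
  open HookColumns {Fin v} _≟ᶠ_ L L!
  open DecMembership (≡-dec (_≟ᶠ_ {v}) (_≟ᶠ_ {v})) using () renaming (_∈?_ to _∈ᵉ?_)

  piece : ∀ {n E R} → Decomposition n E R → ℕ → Edges
  piece []                           i = []
  piece (layer {n} es _ _ _ _ _ D) i with i ≟ n
  ... | yes _ = es
  ... | no  _ = piece D i

  -- Total on all pairs, with default 0 off E, so that it can serve as a labelling; `layerOf≤` holds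
  -- there as well.
  layerOf : ∀ {n E R} → Decomposition n E R → Fin v × Fin v → ℕ
  layerOf []                           e = 0
  layerOf (layer {n} es _ _ _ _ _ D) e with e ∈ᵉ? es
  ... | yes _ = n
  ... | no  _ = layerOf D e

  layerOf≤ : ∀ {n E R} (D : Decomposition n E R) e → layerOf D e ≤ pred n
  layerOf≤ []                           e = z≤n
  layerOf≤ (layer {n} es _ _ _ _ _ D) e with e ∈ᵉ? es
  ... | yes _ = ≤-refl
  ... | no  _ = ≤-trans (layerOf≤ D e) pred[n]≤n

  layerOf< : ∀ {n E R e} (D : Decomposition n E R) → e ∈ E → layerOf D e < n
  layerOf< {suc n} {e = e} D e∈ = s≤s (layerOf≤ D e)
  layerOf< {zero} [] ()

  piece-⊆ : ∀ {n E R} (D : Decomposition n E R) i {e} → e ∈ piece D i → e ∈ E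
  piece-⊆ (layer {n} es p _ _ _ _ D) i e∈ with i ≟ n
  ... | yes _ = ∈-resp-↭ (↭-sym p) (∈-++⁺ˡ e∈)
  ... | no  _ = ∈-resp-↭ (↭-sym p) (∈-++⁺ʳ es (piece-⊆ D i e∈))

  piece-length : ∀ {n E R} (D : Decomposition n E R) {i} → i < n → length (piece D i) ≡ suc i
  piece-length (layer {n} es _ _ len _ _ D) {i} i<n with i ≟ n
  ... | yes refl = len
  ... | no  i≢n  = piece-length D (≤∧≢⇒< (s≤s⁻¹ i<n) i≢n)

  piece-matching : ∀ {n E R} (D : Decomposition n E R) i → Unique (map proj₂ (piece D i))
  piece-matching []                             i = []
  piece-matching (layer {n} es _ _ _ es! _ D) i with i ≟ n
  ... | yes _ = es!
  ... | no  _ = piece-matching D i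

  piece-top : ∀ {n E R} (D : Decomposition (suc n) E R) → map proj₁ (piece D n) ≡ R
  piece-top {n} (layer es _ req _ _ _ D) with n ≟ n
  ... | yes _  = req
  ... | no n≢n = contradiction refl n≢n

  piece-ascends : ∀ {n E R} (D : Decomposition n E R) {i} → suc i < n →
                  Ascends (map proj₁ (piece D i)) (map proj₁ (piece D (suc i)))
  piece-ascends (layer {n} es _ req _ _ asc D) {i} lt with suc i ≟ n | i ≟ n
  ... | yes refl | yes i≡1+i = contradiction (sym i≡1+i) 1+n≢n
  ... | yes refl | no  _     = subst₂ Ascends (sym (piece-top D)) (sym req) asc
  ... | no  i≢   | yes refl  = contradiction (s≤s⁻¹ lt) (<-irrefl refl)
  ... | no  i≢   | no  _     = piece-ascends D (≤∧≢⇒< (s≤s⁻¹ lt) i≢)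

  ∈-piece-layerOf : ∀ {n E R e} (D : Decomposition n E R) → e ∈ E → e ∈ piece D (layerOf D e)
  ∈-piece-layerOf {e = e} (layer {n} es p _ _ _ _ D) e∈ with e ∈ᵉ? es
  ∈-piece-layerOf {e = e} (layer {n} es p _ _ _ _ D) e∈ | yes e∈es with n ≟ n
  ... | yes _  = e∈es
  ... | no n≢n = contradiction refl n≢n
  ∈-piece-layerOf {e = e} (layer {n} es p _ _ _ _ D) e∈ | no e∉es with ∈-++⁻ es (∈-resp-↭ p e∈)
  ... | inj₁ e∈es = contradiction e∈es e∉es
  ... | inj₂ e∈E' with layerOf D e ≟ n
  ...   | yes eq = contradiction (layerOf< D e∈E') (<-irrefl eq)
  ...   | no  _  = ∈-piece-layerOf D e∈E'

  layerOf-piece : ∀ {n E R e} (D : Decomposition n E R) → Unique E → ∀ {i} → i < n → e ∈ piece D i → layerOf D e ≡ i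
  layerOf-piece {e = e} (layer {n} es p _ _ _ _ D) E! {i} i<n e∈ with i ≟ n | e ∈ᵉ? es
  ... | yes refl | yes _    = refl
  ... | yes refl | no e∉es  = contradiction e∈ e∉es
  ... | no i≢n   | no _     = layerOf-piece D (Unique-++ʳ es (Unique-↭ p E!)) (≤∧≢⇒< (s≤s⁻¹ i<n) i≢n) e∈
  ... | no _     | yes e∈es = contradiction (piece-⊆ D i e∈) (Unique-++-disjoint es (Unique-↭ p E!) e∈es)

-- Star forests and embeddings of the labelled parts

module Assemble {v : ℕ} (G : Graph v) (c : Fin v → Bool) (proper : Proper2Colouring G c)
  (L : List (Fin v)) (L! : Unique L)
  (L⁺ : ∀ {x} → c x ≡ true → x ∈ L) (L⁻ : ∀ {x} → x ∈ L → c x ≡ true) where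
  open Requests {Fin v} _≟ᶠ_
  open HookColumns {Fin v} _≟ᶠ_ L L!
  open Layers L L!

  module _ {n : ℕ} {E : Edges} {R : List (Fin v)} (E! : Unique E)
    (E⁺ : ∀ {x y} → c x ≡ true → adj G x y ≡ true → (x , y) ∈ E)
    (E⁻ : ∀ {x y} → (x , y) ∈ E → c x ≡ true × adj G x y ≡ true)
    (D : Decomposition (suc n) E R) where

    index : Fin v × Fin v → Fin (suc n)
    index e = fromℕ< (s≤s (layerOf≤ D e))

    label : Fin v → Fin v → Fin (suc n)
    label x y with c x | c y
    ... | true  | false = index (x , y)
    ... | false | true  = index (y , x)
    -- Pairs inside a colour class are never edges, so a constant default is harmless and keeps the
    -- label symmetric.
    ... | _     | _     = fzero

    label-sym : ∀ x y → label x y ≡ label y x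
    label-sym x y with c x | c y
    ... | true  | true  = refl
    ... | true  | false = refl
    ... | false | true  = refl
    ... | false | false = refl

    label-index : ∀ {x y} → c x ≡ true → c y ≡ false → label x y ≡ index (x , y)
    label-index cx cy rewrite cx | cy = refl

    P : Fin (suc n) → Fin v → Fin v → Bool
    P = part G label

    P-adj : ∀ i {x y} → P i x y ≡ true → adj G x y ≡ true
    P-adj i p = proj₁ (∧-true p)

    P-proper : ∀ i {x y} → P i x y ≡ true → c x ≢ c y
    P-proper i {x} {y} p = proper x y (P-adj i p)

    P-sym : ∀ i x y → P i x y ≡ P i y x
    P-sym i x y = cong₂ (λ a l → a ∧ ⌊ l ≟ᶠ i ⌋) (adj-sym G x y) (label-sym x y)

    other : ∀ i {x y} → P i x y ≡ true → c x ≡ true → c y ≡ false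
    other i {x} {y} p cx = ≢true⇒false (subst (_≢ c y) cx (P-proper i p))

    P⇒piece : ∀ i {x y} → c x ≡ true → P i x y ≡ true → (x , y) ∈ piece D (toℕ i)
    P⇒piece i {x} {y} cx p = subst (λ j → (x , y) ∈ piece D j) layer≡ (∈-piece-layerOf D (E⁺ cx (P-adj i p)))
      where
      layer≡ : layerOf D (x , y) ≡ toℕ i
      layer≡ = trans (sym (toℕ-fromℕ< (s≤s (layerOf≤ D (x , y))))) (cong toℕ
        (trans (sym (label-index cx (other i p cx))) (true-⌊⌋ (label x y ≟ᶠ i) (proj₂ (∧-true {adj G x y} p)))))

    piece⇒P : ∀ i {x y} → (x , y) ∈ piece D (toℕ i) → c x ≡ true × P i x y ≡ true
    piece⇒P i {x} {y} e∈ with cx , axy ← E⁻ (piece-⊆ D (toℕ i) e∈) =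
      cx , cong₂ _∧_ axy (⌊⌋-true (label x y ≟ᶠ i)
        (trans (label-index cx (≢true⇒false (subst (_≢ c y) cx (proper x y axy))))
          (toℕ-injective (trans (toℕ-fromℕ< _) (layerOf-piece D E! (toℕ<n i) e∈)))))

    size : ∀ i → numEdgesRel (P i) ≡ suc (toℕ i)
    size i = trans
      (numEdgesRel-length c (P i) (P-sym i) (P-proper i) (Unique-map⁻ (piece-matching D (toℕ i)))
        (P⇒piece i) (piece⇒P i))
      (piece-length D (toℕ<n i))

    -- Right ends within a piece are distinct, so the leaf y lies on only one of its edges.
    sameCentre : ∀ i {x y z} → c x ≡ true → P i x y ≡ true → P i y z ≡ true → z ≡ x
    sameCentre i {x} {y} {z} cx p q =
      unique-first (piece-matching D (toℕ i)) (P⇒piece i cz (trans (P-sym i z y) q)) (P⇒piece i cx p)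
      where
      cz : c z ≡ true
      cz = ≢false⇒true (subst (_≢ c z) (other i p cx) (P-proper i q))

      unique-first : ∀ {es : Edges} {x z y} → Unique (map proj₂ es) → (z , y) ∈ es → (x , y) ∈ es → z ≡ x
      unique-first u       (here refl) (here refl) = refl
      unique-first u       (here refl) (there e∈)  = contradiction (∈-map⁺ proj₂ e∈) (Unique[x∷xs]⇒x∉xs u)
      unique-first u       (there e∈)  (here refl) = contradiction (∈-map⁺ proj₂ e∈) (Unique[x∷xs]⇒x∉xs u)
      unique-first (_ ∷ u) (there a)   (there b)   = unique-first u a b

    -- A path from a centre is back at it after every second step, since a leaf has no other
    -- neighbour.
    reach : ∀ i {x y} → c x ≡ true → Reach (P i) x y → y ≡ x ⊎ P i x y ≡ true
    reach i cx stay         = inj₁ refl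
    reach i cx (move p rest) = reach-leaf p rest
      where
      reach-leaf : ∀ {y z} → P i _ y ≡ true → Reach (P i) y z → z ≡ _ ⊎ P i _ z ≡ true
      reach-leaf p stay = inj₂ p
      reach-leaf p (move q rest) with refl ← sameCentre i cx p q = reach i cx rest

    starAt : ∀ i {x} → c x ≡ true → ∀ y z → Reach (P i) x y → P i y z ≡ true → y ≡ x ⊎ z ≡ x
    starAt i cx y z xy yz with reach i cx xy
    ... | inj₁ y≡x = inj₁ y≡x
    ... | inj₂ p   = inj₂ (sameCentre i cx p yz)

    starForest : ∀ i → StarForest (P i)
    starForest i x with c x in cx
    ... | true  = x , stay , starAt i cx
    -- An uncoloured vertex takes a neighbour in the part as its centre; without one it is a
    -- component by itself.
    ... | false with any? (λ y → P i x y Bool.≟ true)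
    ...   | yes (y , p) = y , move p stay , λ a b xa → starAt i cy a b (move (trans (P-sym i y x) p) xa)
      where
      cy : c y ≡ true
      cy = ≢false⇒true (subst (_≢ c y) cx (P-proper i p))
    ...   | no isolated = x , stay , λ where
      y z stay          p → inj₁ refl
      y z (move p rest) _ → contradiction (_ , p) isolated

    zipped : ∀ {σ φ : Fin v → Fin v} (es es' : Edges) →
             map proj₁ es' ≡ map σ (map proj₁ es) → map φ (map proj₂ es) ≡ map proj₂ es' →
             es' ≡ map (λ e → σ (proj₁ e) , φ (proj₂ e)) es
    zipped []       []         _  _  = refl
    zipped (e ∷ es) (e' ∷ es') eq₁ eq₂ with refl , eq₁' ← ∷-injective eq₁ | refl , eq₂' ← ∷-injective eq₂ =
      cong (_ ∷_) (zipped es es' eq₁' eq₂')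

    leaf : ∀ i {u} → u ∈ map proj₂ (piece D (toℕ i)) → c u ≡ false
    leaf i u∈ with (x , u) , e∈ , refl ← ∈-map⁻ proj₂ u∈ with cx , p ← piece⇒P i e∈ = other i p cx

    -- `↭-map-inv` lifts the comparison of left ends to edges: e₀ is the additional edge, and es' is
    -- aligned with piece i entry by entry. σ settles the coloured class; right ends are uncoloured,
    -- so they can be sent to those of es' without a clash.
    ascending : ∀ i j → toℕ j ≡ suc (toℕ i) → IsoToSubgraph (P i) (P j)
    ascending i j j≡
      with σ , σ-inj , σ-L , r , perm ← subst (λ k → Ascends (map proj₁ (piece D (toℕ i))) (map proj₁ (piece D k))) (sym j≡)
             (piece-ascends D (subst (_< suc n) j≡ (toℕ<n j)))
      with e₀ ∷ es' , eq , perm' ← ↭-map-inv proj₁ perm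
      with refl , eq' ← ∷-injective eq
      with φ , φ-inj , φ-map , φ-fix ← extendInjection σ-inj (λ x → c x ≡ true)
             (map proj₂ (piece D (toℕ i))) (map proj₂ es')
             (piece-matching D (toℕ i)) (Unique-++ʳ (proj₂ e₀ ∷ []) (Unique-↭ (↭-map⁺ proj₂ perm') (piece-matching D (toℕ j))))
             (trans (length-map proj₂ (piece D (toℕ i))) (trans (sym (length-map proj₁ (piece D (toℕ i))))
               (trans (sym (length-map σ (map proj₁ (piece D (toℕ i))))) (trans (cong length eq')
                 (trans (length-map proj₁ es') (sym (length-map proj₂ es')))))))
             (λ u∈ cu → true≢false cu (leaf i u∈))
             (λ cx w∈ eq → true≢false (L⁻ (σ-L (L⁺ cx))) (trans (cong c eq)
               (leaf j (∈-resp-↭ (↭-sym (↭-map⁺ proj₂ perm')) (there w∈)))))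
      = φ , φ-inj , embed
      where
      fromCentre : ∀ {x y} → c x ≡ true → P i x y ≡ true → P j (φ x) (φ y) ≡ true
      fromCentre {x} {y} cx p = subst (λ z → P j z (φ y) ≡ true) (sym (φ-fix cx))
        (proj₂ (piece⇒P j (∈-resp-↭ (↭-sym perm') (there
          (subst ((σ x , φ y) ∈_) (sym (zipped (piece D (toℕ i)) es' (sym eq') φ-map))
            (∈-map⁺ (λ e → σ (proj₁ e) , φ (proj₂ e)) (P⇒piece i cx p)))))))

      embed : ∀ x y → P i x y ≡ true → P j (φ x) (φ y) ≡ true
      embed x y p with c x Bool.≟ true
      ... | yes cx = fromCentre cx p
      ... | no ¬cx = trans (P-sym j (φ x) (φ y))
        (fromCentre (≢false⇒true (subst (_≢ c y) (≢true⇒false (¬cx ∘ sym)) (P-proper i p))) (trans (P-sym i y x) p))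

    asd : StarForestASD G (suc n)
    asd = record { label = label ; label-sym = label-sym ; size = size ; starF = starForest ; ascending = ascending }

theorem1 : (n : ℕ) → 1 ≤ n → (v : ℕ) (G : Graph v) → numEdges G ≡ suc n C 2 →
    (c : Fin v → Bool) → Proper2Colouring G c → DegreeCondition n (degSeq G c) →
    StarForestASD G n
theorem1 (suc n) _ v G edges c proper dc
  -- `degSeq` sorts degrees, not vertices; the permutation is lifted to an ordering `L₀` of the
  -- class that has these degrees.
  with L₀ , eq , perm ← ↭-map-inv (degree G) (↭-sym (sort-↭ (map (degree G) (filterᵇ c (allFin v))))) =
  Assemble.asd G c proper L L! L⁺ L⁻ E! E⁺ E⁻ (proj₂ D)
  where
  open Requests {Fin v} _≟ᶠ_
  open Ranking {v}

  L : List (Fin v)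
  L = reverse L₀

  L↭ : filterᵇ c (allFin v) ↭ L
  L↭ = ↭-trans perm (↭-sym (↭-reverse L₀))

  L! : Unique L
  L! = Unique-↭ L↭ (Unique-filterᵇ c (allFin⁺ v))

  L⁺ : ∀ {x} → c x ≡ true → x ∈ L
  L⁺ {x} cx = ∈-resp-↭ L↭ (∈-filterᵇ⁺ c (∈-allFin x) cx)

  L⁻ : ∀ {x} → x ∈ L → c x ≡ true
  L⁻ x∈ = proj₂ (∈-filterᵇ⁻ c {xs = allFin v} (∈-resp-↭ (↭-sym L↭) x∈))

  N : Fin v → List (Fin v)
  N x = filterᵇ (adj G x) (allFin v)

  E : Edges
  E = edgesFrom N L

  E! : Unique E
  E! = edgesFrom! N (λ x → Unique-filterᵇ (adj G x) (allFin⁺ v)) L!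

  E⁺ : ∀ {x y} → c x ≡ true → adj G x y ≡ true → (x , y) ∈ E
  E⁺ {x} {y} cx axy = edgesFrom⁺ N (L⁺ cx) (∈-filterᵇ⁺ (adj G x) (∈-allFin y) axy)

  E⁻ : ∀ {x y} → (x , y) ∈ E → c x ≡ true × adj G x y ≡ true
  E⁻ {x} e∈ with x∈ , y∈ ← edgesFrom⁻ N L e∈ = L⁻ x∈ , proj₂ (∈-filterᵇ⁻ (adj G x) {xs = allFin v} y∈)

  E-size : sum (map (degree G) L) ≡ triangle (suc n)
  E-size = trans (sym (edgesFrom-length N L))
    (trans (sym (numEdgesRel-length c (adj G) (adj-sym G) (λ {x} {y} → proper x y) E! E⁺ E⁻))
      (trans edges (triangle≡C (suc n))))

  quota≤ : ∀ x → quota (suc n) L x ≤ degree G x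
  quota≤ = rank⇒quota≤ (suc n) L L! (degreeCondition⇒rank (suc n) L₀ (subst (DegreeCondition (suc n)) eq dc))

  -- The factor `cnt x L` is 1 on the class and 0 off it, as vertices off the class are left ends of
  -- no edge in E.
  surplus : Fin v → ℕ
  surplus x = cnt x L * degree G x ∸ quota (suc n) L x

  outside : ∀ {x} → x ∉ L → surplus x ≡ 0
  outside {x} x∉ = trans (cong (λ t → t * degree G x ∸ quota (suc n) L x) (cnt-∉ L x∉)) (0∸n≡0 (quota (suc n) L x))

  deg≡ : ∀ x → deg E x ≡ quota (suc n) L x + surplus x
  deg≡ x = trans (edgesFrom-deg N L x) (sym (m+[n∸m]≡n (quota≤deg (DecMembership._∈?_ _≟ᶠ_ x L))))
    where
    quota≤deg : Dec (x ∈ L) → quota (suc n) L x ≤ cnt x L * degree G x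
    quota≤deg (yes x∈) rewrite cnt-∈ L! x∈ | +-identityʳ (degree G x) = quota≤ x
    quota≤deg (no x∉)  rewrite quota-∉ (suc n) L x∉ = z≤n

  surplus-sum : sum (map surplus L) ≡ triangle (suc n ∸ length L)
  surplus-sum = +-cancelˡ-≡ (sum (map (quota (suc n) L) L)) _ _ (begin
    sum (map (quota (suc n) L) L) + sum (map surplus L)
      ≡⟨ sum-split L id ⟩
    sum (map (degree G) L)
      ≡⟨ E-size ⟩
    triangle (suc n)
      ≡⟨ sym (quota-sum (suc n) L L!) ⟩
    sum (map (quota (suc n) L) L) + triangle (suc n ∸ length L) ∎)
    where
    open ≡-Reasoning
    lemma : ∀ a b x y → a + x + (b + y) ≡ a + b + (x + y)
    lemma = solve-∀

    sum-split : ∀ xs → (∀ {x} → x ∈ xs → x ∈ L) →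
                sum (map (quota (suc n) L) xs) + sum (map surplus xs) ≡ sum (map (degree G) xs)
    sum-split []       _  = refl
    sum-split (x ∷ xs) ⊆L = trans (lemma (quota (suc n) L x) (surplus x) _ _)
      (cong₂ _+_ (trans (cong (λ t → quota (suc n) L x + (t ∸ quota (suc n) L x)) one) (m+[n∸m]≡n (quota≤ x)))
        (sum-split xs (⊆L ∘ there)))
      where
      one : cnt x L * degree G x ≡ degree G x
      one = trans (cong (_* degree G x) (cnt-∈ L! (⊆L (here refl)))) (+-identityʳ _)

  D : ∃ (HookColumns.Decomposition _≟ᶠ_ L L! (suc n) E)
  D = HookColumns.decompose _≟ᶠ_ L L! (suc n) surplus E! deg≡ (λ {x} → outside {x}) surplus-sum
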